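{- For each integer $n\ge 0$ let $E_{\mathrm{ind}}(n)$ denote the number of partitions $\lambda$ of $n$ into odd parts with $\mathrm{ind}(\lambda)$ odd minus the number of partitions $\lambda$ of $n$ into odd parts with $\mathrm{ind}(\lambda)$ even. Then, as formal power series in $q$, $$\sum_{n\ge 0}(-1)^{\lceil n/2\rceil}E_{\mathrm{ind}}(n)\,q^n=\prod_{n=1}^{\infty}\frac{1}{1+(-1)^n q^{2n-1}}.$$
   Context: A partition of $n$ is a weakly decreasing finite sequence of positive integers with sum $n$; the empty sequence is the only partition of $0$. Meander: given two compositions (or partitions) $\lambda=(\lambda_1,\dots,\lambda_r)$ and $\mu=(\mu_1,\dots,\mu_s)$ of $n$, the meander of type $\frac{\lambda}{\mu}$ is the graph on $n$ vertices placed in a row, with the following edges. Split the row into consecutive blocks of sizes $\lambda_1,\dots,\lambda_r$, and name the vertices of the $i$-th block, in order, $v_{i,1},\dots,v_{i,\lambda_i}$; for each $i$ and each $1\le j\le\lfloor\lambda_i/2\rfloor$ add a "top" edge joining $v_{i,j}$ and $v_{i,\lambda_i+1-j}$. Do the same with $\mu$ in place of $\lambda$ to get "bottom" edges. If a top edge and a bottom edge join the same two vertices, both are kept and they form a cycle (of length 2). Every connected component is a cycle or a path, an isolated vertex being counted as a path. Define $$\mathrm{ind}_\mu(\lambda)=2C+P-1,$$ where $C$ and $P$ are the numbers of cycles and paths of the meander. (By a theorem of Dergachev and Kirillov this is the index of the seaweed Lie algebra of type $\frac{\lambda}{\mu}$ in $\mathfrak{sl}_n$.) Index of a partition: for $\lambda$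 a partition of $n\ge1$, $\mathrm{ind}(\lambda):=\mathrm{ind}_\mu(\lambda)$ where $\mu=(n)$ is the one-part partition. For the empty partition, $\mathrm{ind}(\emptyset):=-1$. -}

module Defs where

open import Data.Bool.Base using (if_then_else_)
open import Data.Integer.Base as ℤ using (ℤ; +_; 0ℤ; 1ℤ; -1ℤ)
import Data.Integer.Properties as ℤ
import Data.Integer.Divisibility.Signed as ℤ
open import Data.List.Base
  using (List; []; _∷_; [_]; _++_; map; concatMap; filter; deduplicate;
         foldr; length; upTo; applyUpTo)
open import Data.List.Membership.Propositional using (_∈_; lose; find)
open import Data.List.Membership.Propositional.Properties
  using (∈-∃++; ∈-map⁺; ∈-map⁻; ∈-concatMap⁺; ∈-concatMap⁻;
         ∈-upTo⁺; ∈-upTo⁻)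
import Data.List.Membership.DecPropositional as DecMembership
open import Data.List.Relation.Unary.All using (All; []; _∷_; all?)
import Data.List.Relation.Unary.All as All
import Data.List.Relation.Unary.All.Properties as All
open import Data.List.Relation.Unary.AllPairs using ([]; _∷_)
import Data.List.Relation.Unary.AllPairs as AllPairs
import Data.List.Relation.Unary.AllPairs.Properties as AllPairs
open import Data.List.Relation.Unary.Any using (here; there; any?)
open import Data.List.Relation.Unary.Linked using (Linked; []; [-]; _∷_)
open import Data.List.Relation.Unary.Unique.Propositional using (Unique)
import Data.List.Relation.Unary.Unique.Propositional.Properties as Unique
open import Data.List.Relation.Binary.Permutation.Propositional
  using (_↭_; ↭-refl; ↭-sym; ↭-trans; prep)
open import Data.List.Relation.Binary.Permutation.Propositional.Properties
  using (shift; drop-mid; ∈-resp-↭; ↭-empty-inv; ¬x∷xs↭[])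
open import Data.List.Properties using (∷-injectiveˡ; ∷-injectiveʳ)
open import Data.Nat.Base
  using (ℕ; zero; suc; _+_; _*_; _∸_; _⊓_; _⊔_; ⌊_/2⌋; ⌈_/2⌉;
         _≤_; _<_; _≥_; z≤n; s≤s)
open import Data.Nat.ListAction using (sum)
open import Data.Nat.Divisibility using (_∣_; _∣?_)
import Data.Nat.Properties as ℕ
open import Data.Product.Base using (∃-syntax; _×_; _,_; proj₁; proj₂)
open import Data.Product.Properties using (≡-dec)
open import Data.Sum.Base using (_⊎_; inj₁; inj₂)
open import Data.Vec.Base as Vec using (Vec; []; _∷_)
open import Function.Base using (_∘_)
open import Relation.Binary.Construct.Closure.Equivalence using (EqClosure)
import Relation.Binary.Construct.Closure.Equivalence as EqClosure
open import Relation.Binary.Construct.Closure.ReflexiveTransitive using (ε; _◅_; _◅◅_)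
open import Relation.Binary.Construct.Closure.Symmetric using (fwd; bwd)
open import Relation.Binary.PropositionalEquality
  using (_≡_; _≢_; refl; sym; trans; cong; cong₂; module ≡-Reasoning)
open import Relation.Nullary using (¬_; Dec; yes; no; contradiction)
open import Relation.Nullary.Decidable
  using (does; map′; ¬?; _×-dec_; _⊎-dec_)

------------------------------------------------------------------------
-- Multigraphs on the vertices 0, …, size − 1

Edge : Set
Edge = ℕ × ℕ

-- The unordered pair {u, v}, stored with its smaller end first, so that two
-- edges with the same ends are equal.
edge : ℕ → ℕ → Edge
edge u v = u ⊓ v , u ⊔ v

-- Repeated entries of the list of edges are parallel edges.
record Multigraph : Set where
  constructor multigraph
  field
    size  : ℕ
    edges : List Edge

Connected : List Edge → ℕ → ℕ → Set
Connected es = EqClosure (λ u v → (u , v) ∈ es)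

weaken : ∀ {e es u v} → Connected es u v → Connected (e ∷ es) u v
weaken = EqClosure.map there

Via : Edge → List Edge → ℕ → ℕ → Set
Via (a , b) es u v =
  Connected es u v
    ⊎ (Connected es u a × Connected es b v)
    ⊎ (Connected es u b × Connected es a v)

via⇒connected : ∀ e es {u v} → Via e es u v → Connected (e ∷ es) u v
via⇒connected e es (inj₁ p) = weaken p
via⇒connected e es (inj₂ (inj₁ (p , q))) = weaken p ◅◅ fwd (here refl) ◅ weaken q
via⇒connected e es (inj₂ (inj₂ (p , q))) = weaken p ◅◅ bwd (here refl) ◅ weaken q

connected⇒via : ∀ e es {u v} → Connected (e ∷ es) u v → Via e es u v
connected⇒via e es ε = inj₁ ε
connected⇒via e es (fwd (here refl) ◅ p) with connected⇒via e es p
... | inj₁ q              = inj₂ (inj₁ (ε , q))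
... | inj₂ (inj₁ (_ , r)) = inj₂ (inj₁ (ε , r))
... | inj₂ (inj₂ (_ , r)) = inj₁ r
connected⇒via e es (bwd (here refl) ◅ p) with connected⇒via e es p
... | inj₁ q              = inj₂ (inj₂ (ε , q))
... | inj₂ (inj₁ (_ , r)) = inj₁ r
... | inj₂ (inj₂ (_ , r)) = inj₂ (inj₂ (ε , r))
connected⇒via e es (fwd (there f) ◅ p) with connected⇒via e es p
... | inj₁ q              = inj₁ (fwd f ◅ q)
... | inj₂ (inj₁ (q , r)) = inj₂ (inj₁ (fwd f ◅ q , r))
... | inj₂ (inj₂ (q , r)) = inj₂ (inj₂ (fwd f ◅ q , r))
connected⇒via e es (bwd (there f) ◅ p) with connected⇒via e es p
... | inj₁ q              = inj₁ (bwd f ◅ q)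
... | inj₂ (inj₁ (q , r)) = inj₂ (inj₁ (bwd f ◅ q , r))
... | inj₂ (inj₂ (q , r)) = inj₂ (inj₂ (bwd f ◅ q , r))

connected? : ∀ es u v → Dec (Connected es u v)
connected? [] u v = map′ (λ { refl → ε }) discrete (u ℕ.≟ v)
  where
  discrete : ∀ {u v} → Connected [] u v → u ≡ v
  discrete ε = refl
  discrete (fwd () ◅ _)
  discrete (bwd () ◅ _)
connected? (e@(a , b) ∷ es) u v =
  map′ (via⇒connected e es) (connected⇒via e es)
    (connected? es u v
      ⊎-dec (connected? es u a ×-dec connected? es b v)
      ⊎-dec (connected? es u b ×-dec connected? es a v))

record Component : Set where
  constructor component
  field
    vertices : List ℕ
    edges    : List Edge

componentOf : Multigraph → ℕ → Component
componentOf (multigraph n es) v = component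
  (filter (connected? es v) (upTo n))
  (filter (connected? es v ∘ proj₁) es)

-- One component for each class of the relation of being connected.
components : Multigraph → List Component
components G@(multigraph n es) =
  map (componentOf G) (deduplicate (connected? es) (upTo n))

pathEdges : List ℕ → List Edge
pathEdges (x ∷ xs@(y ∷ _)) = edge x y ∷ pathEdges xs
pathEdges _                = []

cycleEdges : List ℕ → List Edge
cycleEdges []          = []
cycleEdges xs@(x ∷ _)  = pathEdges (xs ++ [ x ])

-- The vertices can be listed, each once, so that the edges are, with
-- multiplicity, exactly those between consecutive vertices; for a cycle, also
-- from the last vertex to the first.
IsPath IsCycle : Component → Set
IsPath  (component vs es) = ∃[ xs ] (xs ↭ vs × pathEdges xs ↭ es)
IsCycle (component vs es) = ∃[ xs ] (xs ↭ vs × cycleEdges xs ↭ es)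

module _ {A : Set} where

  insertions : A → List A → List (List A)
  insertions x []       = [ [ x ] ]
  insertions x (y ∷ ys) = (x ∷ y ∷ ys) ∷ map (y ∷_) (insertions x ys)

  permutations : List A → List (List A)
  permutations []       = [ [] ]
  permutations (x ∷ xs) = concatMap (insertions x) (permutations xs)

  insertions-complete : ∀ x ys zs → ys ++ x ∷ zs ∈ insertions x (ys ++ zs)
  insertions-complete x []       []      = here refl
  insertions-complete x []       (_ ∷ _) = here refl
  insertions-complete x (y ∷ ys) zs      =
    there (∈-map⁺ (y ∷_) (insertions-complete x ys zs))

  permutations-complete : ∀ ys {xs} → xs ↭ ys → xs ∈ permutations ys
  permutations-complete [] p with refl ← ↭-empty-inv p = here refl
  permutations-complete (y ∷ ys) p
    with ls , rs , refl ← ∈-∃++ (∈-resp-↭ (↭-sym p) (here refl)) =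
    ∈-concatMap⁺ (insertions y)
      (lose (permutations-complete ys (drop-mid ls [] p)) (insertions-complete y ls rs))

  some↭? : ∀ {P : List A → Set} → (∀ xs ys → Dec (xs ↭ ys)) → (∀ xs → Dec (P xs)) →
           ∀ ys → Dec (∃[ xs ] (xs ↭ ys × P xs))
  some↭? _↭?_ P? ys = map′
    (λ p → let xs , _ , q = find p in xs , q)
    (λ { (xs , p , q) → lose (permutations-complete ys p) (p , q) })
    (any? (λ xs → (xs ↭? ys) ×-dec P? xs) (permutations ys))

module _ {A : Set} (_≟_ : ∀ (x y : A) → Dec (x ≡ y)) where

  open DecMembership _≟_ using (_∈?_)

  ↭-dec : ∀ (xs ys : List A) → Dec (xs ↭ ys)
  ↭-dec []       []       = yes ↭-refl
  ↭-dec []       (y ∷ ys) = no (λ p → ¬x∷xs↭[] (↭-sym p))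
  ↭-dec (x ∷ xs) ys with x ∈? ys
  ... | no x∉ys = no (λ p → x∉ys (∈-resp-↭ p (here refl)))
  ... | yes x∈ys with ls , rs , refl ← ∈-∃++ x∈ys =
    map′ (λ p → ↭-trans (prep x p) (↭-sym (shift x ls rs)))
         (drop-mid [] ls)
         (↭-dec xs (ls ++ rs))

isPath? : ∀ c → Dec (IsPath c)
isPath? (component vs es) =
  some↭? (↭-dec ℕ._≟_) (λ xs → ↭-dec (≡-dec ℕ._≟_ ℕ._≟_) (pathEdges xs) es) vs

isCycle? : ∀ c → Dec (IsCycle c)
isCycle? (component vs es) =
  some↭? (↭-dec ℕ._≟_) (λ xs → ↭-dec (≡-dec ℕ._≟_ ℕ._≟_) (cycleEdges xs) es) vs

#cycles #paths : Multigraph → ℕ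
#cycles G = length (filter isCycle? (components G))
#paths  G = length (filter isPath?  (components G))

------------------------------------------------------------------------
-- Meanders and the index

-- The arcs of a block of m vertices starting at the vertex s.  Counting
-- vertices and j from 0, the arc from v_{j+1} to v_{m+1-(j+1)} joins s + j to
-- s + (m ∸ 1 ∸ j).
blockArcs : ℕ → ℕ → List Edge
blockArcs s m = map (λ j → edge (s + j) (s + (m ∸ 1 ∸ j))) (upTo ⌊ m /2⌋)

arcsFrom : ℕ → List ℕ → List Edge
arcsFrom s []       = []
arcsFrom s (m ∷ ms) = blockArcs s m ++ arcsFrom (s + m) ms

-- Meant for lists of positive integers xs and ys with the same sum.
meander : List ℕ → List ℕ → Multigraph
meander xs ys = multigraph (sum xs) (arcsFrom 0 xs ++ arcsFrom 0 ys)

-- ind[ μ ] λ is ind_μ(λ).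
ind[_] : List ℕ → List ℕ → ℤ
ind[ ys ] xs = + (2 * #cycles G + #paths G) ℤ.- 1ℤ
  where G = meander xs ys

ind : List ℕ → ℤ
ind []         = -1ℤ
ind xs@(_ ∷ _) = ind[ [ sum xs ] ] xs

------------------------------------------------------------------------
-- Partitions

IsPartition : ℕ → List ℕ → Set
IsPartition n xs = Linked _≥_ xs × All (0 <_) xs × sum xs ≡ n

-- The partitions of n into at most l parts, none of them larger than m.
boundedPartitions : (l m n : ℕ) → List (List ℕ)
boundedPartitions l       m zero    = [ [] ]
boundedPartitions zero    m (suc n) = []
boundedPartitions (suc l) m (suc n) =
  concatMap (λ k → map (suc k ∷_) (boundedPartitions l (suc k) (n ∸ k)))
            (upTo (m ⊓ suc n))

partitions : ℕ → List (List ℕ)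
partitions n = boundedPartitions n n n

private
  cons : ∀ {m xs} → Linked _≥_ xs → All (_≤ m) xs → Linked _≥_ (m ∷ xs)
  cons []         []      = [-]
  cons [-]        (q ∷ _) = q ∷ [-]
  cons (p ∷ ps)   (q ∷ _) = q ∷ p ∷ ps

  uncons : ∀ {m xs} → Linked _≥_ (m ∷ xs) → Linked _≥_ xs × All (_≤ m) xs
  uncons [-]      = [] , []
  uncons (p ∷ ps) = ps , p ∷ All.map (λ q → ℕ.≤-trans q p) (proj₂ (uncons ps))

  bounded-sound : ∀ l m n {xs} → xs ∈ boundedPartitions l m n →
                  IsPartition n xs × All (_≤ m) xs
  bounded-sound zero    m zero (here refl) = ([] , [] , refl) , []
  bounded-sound (suc l) m zero (here refl) = ([] , [] , refl) , []
  bounded-sound (suc l) m (suc n) xs∈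
    with k , k∈ , xs∈′ ← find (∈-concatMap⁻
           (λ k → map (suc k ∷_) (boundedPartitions l (suc k) (n ∸ k)))
           {xs = upTo (m ⊓ suc n)} xs∈)
    with ys , ys∈ , refl ← ∈-map⁻ (suc k ∷_) xs∈′
    with (ys↘ , ys>0 , Σys) , ys≤ ← bounded-sound l (suc k) (n ∸ k) ys∈ =
    ( cons ys↘ ys≤
    , s≤s z≤n ∷ ys>0
    , cong suc (trans (cong (_+_ k) Σys) (ℕ.m+[n∸m]≡n (ℕ.≤-pred (ℕ.m<n⊓o⇒m<o m _ k<))))
    ) , ℕ.m<n⊓o⇒m<n m _ k< ∷ All.map (λ p → ℕ.≤-trans p (ℕ.m<n⊓o⇒m<n m _ k<)) ys≤
    where k< = ∈-upTo⁻ k∈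

  bounded-complete : ∀ l m n xs → length xs ≤ l → All (_≤ m) xs → IsPartition n xs →
                     xs ∈ boundedPartitions l m n
  bounded-complete zero    m .zero [] _ _ (_ , _ , refl) = here refl
  bounded-complete (suc l) m .zero [] _ _ (_ , _ , refl) = here refl
  bounded-complete (suc l) m _ (suc k ∷ xs) (s≤s len) (k< ∷ _) (xs↘ , _ ∷ xs>0 , refl)
    with xs↘′ , xs≤ ← uncons xs↘ =
    ∈-concatMap⁺ (λ j → map (suc j ∷_) (boundedPartitions l (suc j) (k + sum xs ∸ j)))
      (lose (∈-upTo⁺ (ℕ.⊓-pres-m< k< (s≤s (ℕ.m≤m+n k (sum xs)))))
            (∈-map⁺ (suc k ∷_)
              (bounded-complete l (suc k) _ xs len xs≤
                (xs↘′ , xs>0 , sym (ℕ.m+n∸m≡n k (sum xs))))))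

  bounded-unique : ∀ l m n → Unique (boundedPartitions l m n)
  bounded-unique zero    m zero    = [] ∷ []
  bounded-unique (suc l) m zero    = [] ∷ []
  bounded-unique zero    m (suc n) = []
  bounded-unique (suc l) m (suc n) = Unique.concat⁺
    (All.map⁺ (All.universal
      (λ k → Unique.map⁺ ∷-injectiveʳ (bounded-unique l (suc k) (n ∸ k))) _))
    (AllPairs.map⁺ (AllPairs.map disjoint (Unique.upTo⁺ (m ⊓ suc n))))
    where
    disjoint : ∀ {j k} {xss yss : List (List ℕ)} → j ≢ k →
               ∀ {zs} → ¬ (zs ∈ map (suc j ∷_) xss × zs ∈ map (suc k ∷_) yss)
    disjoint j≢k (p , q) with _ , _ , refl ← ∈-map⁻ _ p | _ , _ , eq ← ∈-map⁻ _ q =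
      j≢k (ℕ.suc-injective (∷-injectiveˡ eq))

  length≤sum : ∀ {xs} → All (0 <_) xs → length xs ≤ sum xs
  length≤sum []       = z≤n
  length≤sum (p ∷ ps) = ℕ.+-mono-≤ p (length≤sum ps)

  parts≤sum : ∀ xs → All (_≤ sum xs) xs
  parts≤sum []       = []
  parts≤sum (x ∷ xs) = ℕ.m≤m+n x (sum xs) ∷
    All.map (λ p → ℕ.≤-trans p (ℕ.m≤n+m (sum xs) x)) (parts≤sum xs)

partitions-sound : ∀ n {xs} → xs ∈ partitions n → IsPartition n xs
partitions-sound n xs∈ = proj₁ (bounded-sound n n n xs∈)

partitions-complete : ∀ n {xs} → IsPartition n xs → xs ∈ partitions n
partitions-complete _ {xs} p@(_ , xs>0 , refl) =
  bounded-complete _ _ _ xs (length≤sum xs>0) (parts≤sum xs) p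

partitions-unique : ∀ n → Unique (partitions n)
partitions-unique n = bounded-unique n n n

oddPartitions : ℕ → List (List ℕ)
oddPartitions n = filter (all? (λ x → ¬? (2 ∣? x))) (partitions n)

E-ind : ℕ → ℤ
E-ind n = + length (filter (λ xs → ¬? (even? xs)) (oddPartitions n))
          ℤ.- + length (filter even? (oddPartitions n))
  where
  even? : ∀ xs → Dec (+ 2 ℤ.∣ ind xs)
  even? xs = + 2 ℤ.∣? ind xs

------------------------------------------------------------------------
-- Formal power series with integer coefficients

-- The function sending n to the coefficient of qⁿ.
PowerSeries : Set
PowerSeries = ℕ → ℤ

infixl 6 _⊕_
infixl 7 _⊗_
infixr 8 _q^_

_q^_ : ℤ → ℕ → PowerSeries
(c q^ d) n = if does (n ℕ.≟ d) then c else 0ℤ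

𝟏 : PowerSeries
𝟏 = 1ℤ q^ 0

_⊕_ : PowerSeries → PowerSeries → PowerSeries
(f ⊕ g) n = f n ℤ.+ g n

_⊗_ : PowerSeries → PowerSeries → PowerSeries
(f ⊗ g) n = foldr ℤ._+_ 0ℤ (applyUpTo (λ i → f i ℤ.* g (n ∸ i)) (suc n))

dot : ∀ {n} → PowerSeries → Vec ℤ n → ℤ
dot h []       = 0ℤ
dot h (c ∷ cs) = h 0 ℤ.* c ℤ.+ dot (h ∘ suc) cs

-- The coefficients of the reciprocal of f, from that of qⁿ down to that of q⁰.
recipCoefficients : PowerSeries → (n : ℕ) → Vec ℤ (suc n)
recipCoefficients f zero    = 1ℤ ∷ []
recipCoefficients f (suc n) = ℤ.- dot (f ∘ suc) cs ∷ cs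
  where cs = recipCoefficients f n

-- The reciprocal of a series with constant coefficient 1; see recip-inverse.
recip : PowerSeries → PowerSeries
recip f n = Vec.head (recipCoefficients f n)

dot-recip : ∀ f h n → dot h (recipCoefficients f n) ≡ (h ⊗ recip f) n
dot-recip f h zero    = refl
dot-recip f h (suc n) =
  cong (λ c → h 0 ℤ.* recip f (suc n) ℤ.+ c) (dot-recip f (h ∘ suc) n)

recip-inverse : ∀ f → f 0 ≡ 1ℤ → ∀ n → (f ⊗ recip f) n ≡ 𝟏 n
recip-inverse f f₀≡1 zero rewrite f₀≡1 = refl
recip-inverse f f₀≡1 (suc n) = begin
  f 0 ℤ.* recip f (suc n) ℤ.+ ((f ∘ suc) ⊗ recip f) n
    ≡⟨ cong (λ c → c ℤ.* recip f (suc n) ℤ.+ ((f ∘ suc) ⊗ recip f) n) f₀≡1 ⟩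
  1ℤ ℤ.* recip f (suc n) ℤ.+ ((f ∘ suc) ⊗ recip f) n
    ≡⟨ cong₂ ℤ._+_ (ℤ.*-identityˡ (recip f (suc n))) (sym (dot-recip f (f ∘ suc) n)) ⟩
  recip f (suc n) ℤ.+ dot (f ∘ suc) (recipCoefficients f n)
    ≡⟨ ℤ.+-inverseˡ (dot (f ∘ suc) (recipCoefficients f n)) ⟩
  0ℤ ∎
  where open ≡-Reasoning

-- The product of a 1, …, a N.
partialProduct : (ℕ → PowerSeries) → ℕ → PowerSeries
partialProduct a zero    = 𝟏
partialProduct a (suc N) = partialProduct a N ⊗ a (suc N)

-- f is the product of a n over all n ≥ 1: every coefficient of the partial
-- products is eventually constant, with the corresponding coefficient of f as
-- its final value.
infix 4 _≐∏_
_≐∏_ : PowerSeries → (ℕ → PowerSeries) → Set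
f ≐∏ a = ∀ k → ∃[ N ] (∀ M → N ≤ M → partialProduct a M k ≡ f k)

{-# OPTIONS --safe #-}

-- Every component of a meander is a path or a cycle, so P is the number of
-- vertices minus the number of edges.  Hence P + Σ ⌊λᵢ/2⌋ = ⌈n/2⌉, and since
-- ind(λ) is odd exactly when P is even, λ contributes (-1)^P to E-ind(n) and
-- (-1)^(⌈n/2⌉ + P) = (-1)^(Σ ⌊λᵢ/2⌋) to the coefficient of qⁿ.  This weight is
-- multiplicative in the parts, a part 2k - 1 having the weight (-1)^(k - 1), so
-- its generating function over the partitions into odd parts is the product of
-- the geometric series 1 / (1 + (-1)^k q^(2k-1)).
module Submission where

open import Defs
open import Data.Integer.Base using (ℤ; 1ℤ; -1ℤ; _^_) renaming (_*_ to _*ℤ_)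
open import Data.Nat.Base using (ℕ; _*_; _∸_; ⌈_/2⌉)

import Algebra.Properties.CommutativeSemigroup as CommutativeSemigroup
import Algebra.Solver.CommutativeMonoid as CommutativeMonoidSolver
open import Data.Bool.Base using (true; false; if_then_else_)
open import Data.Integer.Base as ℤ using (0ℤ; -_)
  renaming (_+_ to _+ℤ_; _-_ to _-ℤ_)
import Data.Integer.Divisibility.Signed as ℤ
import Data.Integer.Properties as ℤ
open import Data.Integer.Solver using () renaming (module +-*-Solver to ℤ-Solver)
open import Data.List.Base
  using (List; []; _∷_; [_]; _++_; _∷ʳ_; map; concatMap; filter; foldr; reverse; length;
         upTo; applyUpTo; deduplicate)
open import Data.List.Membership.Propositional using (_∈_; find)
open import Data.List.Membership.Propositional.Properties
  using (∈-∃++; ∈-concatMap⁻; ∈-++⁺ˡ; ∈-++⁺ʳ; ∈-++⁻; ∈-concat⁺′; ∈-map⁺; ∈-upTo⁻; ∈-filter⁻)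
open import Data.List.Properties
  using (map-++; map-∘; map-upTo; map-cong-local; filter-++; filter-all; filter-none;
         filter-accept; filter-reject; concatMap-++; concatMap-cong; ++-identityʳ;
         upTo-∷ʳ; applyUpTo-∷ʳ; reverse-++; unfold-reverse;
         length-++; length-map; length-upTo)
open import Data.List.Relation.Binary.Permutation.Propositional as ↭
  using (_↭_; prep; swap; ↭-refl; ↭-sym; ↭-trans; ↭-reflexive; ↭-swap; ↭⇒↭ₛ;
         module PermutationReasoning)
open import Data.List.Relation.Binary.Permutation.Propositional.Properties
  using (shift; shifts; drop-∷; ∷↭∷ʳ; ∈-resp-↭; All-resp-↭; ↭-reverse; ↭-length; filter-↭;
         ++⁺; ++⁺ˡ; ++⁺ʳ; ++-comm; ++-assoc; ++-commutativeMonoid)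
import Data.List.Relation.Binary.Permutation.Setoid.Properties as Permutation
open import Data.List.Relation.Unary.All as All using (All; []; _∷_; all?)
import Data.List.Relation.Unary.All.Properties as All
open import Data.List.Relation.Unary.AllPairs using (AllPairs; []; _∷_)
import Data.List.Relation.Unary.AllPairs.Properties as AllPairs
open import Data.List.Relation.Unary.Any as Any using (Any; here; there)
import Data.List.Relation.Unary.Any.Properties as Any
open import Data.List.Relation.Unary.Unique.Propositional using (Unique)
import Data.List.Relation.Unary.Unique.Propositional.Properties as Unique
open import Data.Nat.Base
  using (zero; suc; _+_; _⊓_; _≤_; _<_; _≤′_; ≤′-reflexive; ≤′-step; s≤s; ⌊_/2⌋)
open import Data.Nat.Divisibility using (_∣_; _∣?_; divides; ∣1⇒≡1; ∣m+n∣m⇒∣n; m∣m*n)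
open import Data.Nat.ListAction using (sum)
import Data.Nat.Properties as ℕ
open import Data.Nat.Solver using () renaming (module +-*-Solver to ℕ-Solver)
open import Data.Product.Base using (∃-syntax; _×_; _,_; proj₁; proj₂)
open import Data.Sum.Base using (_⊎_; inj₁; inj₂)
open import Function.Base using (_∘_)
import Relation.Binary.Construct.Closure.Equivalence as EqClosure
open import Relation.Binary.Construct.Closure.ReflexiveTransitive using (ε; _◅_; _◅◅_)
open import Relation.Binary.Construct.Closure.Symmetric using (fwd; bwd)
open import Relation.Binary.PropositionalEquality as ≡
  using (_≡_; _≢_; refl; sym; trans; cong; cong₂; subst; module ≡-Reasoning)
open import Relation.Nullary using (¬_; Dec; yes; no; does; contradiction)
open import Relation.Nullary.Decidable using (¬?; dec-true; dec-false)

open CommutativeSemigroup ℕ.+-commutativeSemigroup using (x∙yz≈y∙xz)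
open CommutativeMonoidSolver (++-commutativeMonoid {A = ℕ})
  using (_⊜_) renaming (solve to ↭-solve; _⊕_ to _⊞_)

-- Formal power series

-- The difficulty is that `#paths` filters a deduplicated list of components by a decided predicate,
-- which says little about the shape of a component. The edges are therefore added one at a time to
-- a list of explicit paths and cycles. The degree bound 2 is kept as a permutation
-- `ends es ++ zs ↭ vs ++ vs`, where `zs` pads the edge ends to two copies of every vertex. That
-- list settles the shape of each component, and P follows by counting: vertices minus edges is 1 on
-- a path and 0 on a cycle. In 2C + P - 1 the cycles carry the factor 2, so P alone decides the
-- parity. On the other side the geometric series are never expanded. Let A_m be the weighted
-- generating function of the partitions into odd parts at most m. Deciding whether the largest part
-- is m gives A_m (1 - c q^m) = A_(m-1) for an odd m of weight c, so a new part means one division,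
-- while A_m = A_(m-1) for even m.

⊗-congˡ : ∀ {f f′} g → (∀ n → f n ≡ f′ n) → ∀ n → (f ⊗ g) n ≡ (f′ ⊗ g) n
⊗-congˡ g f≗f′ zero    = cong (λ c → c *ℤ g 0 +ℤ 0ℤ) (f≗f′ 0)
⊗-congˡ g f≗f′ (suc n) =
  cong₂ _+ℤ_ (cong (_*ℤ g (suc n)) (f≗f′ 0)) (⊗-congˡ g (f≗f′ ∘ suc) n)

⊗-congʳ : ∀ f {g g′} → (∀ n → g n ≡ g′ n) → ∀ n → (f ⊗ g) n ≡ (f ⊗ g′) n
⊗-congʳ f g≗g′ zero    = cong (λ c → f 0 *ℤ c +ℤ 0ℤ) (g≗g′ 0)
⊗-congʳ f g≗g′ (suc n) =
  cong₂ _+ℤ_ (cong (f 0 *ℤ_) (g≗g′ (suc n))) (⊗-congʳ (f ∘ suc) g≗g′ n)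

-- The shape `a *ℤ u i +ℤ v i` is that of `(f ⊗ g) ∘ suc`, namely `f 0` times the shift of `g` plus
-- `(f ∘ suc) ⊗ g`; this drives the induction for associativity.
⊗-linearˡ : ∀ a u v g n →
  ((λ i → a *ℤ u i +ℤ v i) ⊗ g) n ≡ a *ℤ (u ⊗ g) n +ℤ (v ⊗ g) n
⊗-linearˡ a u v g zero    =
  solve 4 (λ a x y z → (a :* x :+ y) :* z :+ con 0ℤ :=
                       a :* (x :* z :+ con 0ℤ) :+ (y :* z :+ con 0ℤ))
    refl a (u 0) (v 0) (g 0)
  where open ℤ-Solver
⊗-linearˡ a u v g (suc n) = trans
  (cong ((a *ℤ u 0 +ℤ v 0) *ℤ g (suc n) +ℤ_) (⊗-linearˡ a (u ∘ suc) (v ∘ suc) g n))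
  (solve 6 (λ a x y z p q → (a :* x :+ y) :* z :+ (a :* p :+ q) :=
                            a :* (x :* z :+ p) :+ (y :* z :+ q))
    refl a (u 0) (v 0) (g (suc n)) (((u ∘ suc) ⊗ g) n) (((v ∘ suc) ⊗ g) n))
  where open ℤ-Solver

⊗-assoc : ∀ f g h n → ((f ⊗ g) ⊗ h) n ≡ (f ⊗ (g ⊗ h)) n
⊗-assoc f g h zero    =
  solve 3 (λ x y z → (x :* y :+ con 0ℤ) :* z :+ con 0ℤ :=
                     x :* (y :* z :+ con 0ℤ) :+ con 0ℤ)
    refl (f 0) (g 0) (h 0)
  where open ℤ-Solver
⊗-assoc f g h (suc n) = begin
  (f ⊗ g) 0 *ℤ h (suc n) +ℤ (((f ⊗ g) ∘ suc) ⊗ h) n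
    ≡⟨ cong ((f ⊗ g) 0 *ℤ h (suc n) +ℤ_)
         (trans (⊗-linearˡ (f 0) (g ∘ suc) ((f ∘ suc) ⊗ g) h n)
                (cong (f 0 *ℤ ((g ∘ suc) ⊗ h) n +ℤ_) (⊗-assoc (f ∘ suc) g h n))) ⟩
  (f ⊗ g) 0 *ℤ h (suc n) +ℤ (f 0 *ℤ ((g ∘ suc) ⊗ h) n +ℤ ((f ∘ suc) ⊗ (g ⊗ h)) n)
    ≡⟨ solve 5 (λ x y z p q → (x :* y :+ con 0ℤ) :* z :+ (x :* p :+ q) :=
                              x :* (y :* z :+ p) :+ q)
         refl (f 0) (g 0) (h (suc n)) (((g ∘ suc) ⊗ h) n) (((f ∘ suc) ⊗ (g ⊗ h)) n) ⟩
  (f ⊗ (g ⊗ h)) (suc n) ∎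
  where
  open ≡-Reasoning
  open ℤ-Solver

⊗-distribˡ-⊕ : ∀ f g h n → (f ⊗ (g ⊕ h)) n ≡ (f ⊗ g) n +ℤ (f ⊗ h) n
⊗-distribˡ-⊕ f g h zero    =
  solve 3 (λ x y z → x :* (y :+ z) :+ con 0ℤ := (x :* y :+ con 0ℤ) :+ (x :* z :+ con 0ℤ))
    refl (f 0) (g 0) (h 0)
  where open ℤ-Solver
⊗-distribˡ-⊕ f g h (suc n) = trans
  (cong (f 0 *ℤ (g (suc n) +ℤ h (suc n)) +ℤ_) (⊗-distribˡ-⊕ (f ∘ suc) g h n))
  (solve 5 (λ x y z p q → x :* (y :+ z) :+ (p :+ q) := (x :* y :+ p) :+ (x :* z :+ q))
    refl (f 0) (g (suc n)) (h (suc n)) (((f ∘ suc) ⊗ g) n) (((f ∘ suc) ⊗ h) n))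
  where open ℤ-Solver

q^-≢ : ∀ c {d n} → n ≢ d → (c q^ d) n ≡ 0ℤ
q^-≢ c {d} {n} n≢d rewrite dec-false (n ℕ.≟ d) n≢d = refl

q^-≡ : ∀ c d → (c q^ d) d ≡ c
q^-≡ c d rewrite dec-true (d ℕ.≟ d) refl = refl

⊗-q^-< : ∀ f c {d n} → n < d → (f ⊗ c q^ d) n ≡ 0ℤ
⊗-q^-< f c {n = zero}  n<d
  rewrite q^-≢ c (ℕ.<⇒≢ n<d) | ℤ.*-zeroʳ (f 0) = refl
⊗-q^-< f c {n = suc n} n<d
  rewrite q^-≢ c (ℕ.<⇒≢ n<d) | ℤ.*-zeroʳ (f 0) | ⊗-q^-< (f ∘ suc) c (ℕ.<⇒≤ n<d) = refl

⊗-q^-+ : ∀ f c d k → (f ⊗ c q^ d) (k + d) ≡ f k *ℤ c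
⊗-q^-+ f c zero    zero    = ℤ.+-identityʳ (f 0 *ℤ c)
⊗-q^-+ f c (suc d) zero
  rewrite q^-≡ c (suc d) | ⊗-q^-< (f ∘ suc) c (ℕ.n<1+n d) = ℤ.+-identityʳ (f 0 *ℤ c)
⊗-q^-+ f c d       (suc k)
  rewrite q^-≢ c (λ eq → ℕ.<⇒≢ (s≤s (ℕ.m≤n+m d k)) (sym eq)) | ℤ.*-zeroʳ (f 0) =
  trans (ℤ.+-identityˡ _) (⊗-q^-+ (f ∘ suc) c d k)

⊗-identityʳ : ∀ f n → (f ⊗ 𝟏) n ≡ f n
⊗-identityʳ f n = begin
  (f ⊗ 𝟏) n       ≡⟨ cong (f ⊗ 𝟏) (ℕ.+-identityʳ n) ⟨
  (f ⊗ 𝟏) (n + 0) ≡⟨ ⊗-q^-+ f 1ℤ 0 n ⟩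
  f n *ℤ 1ℤ       ≡⟨ ℤ.*-identityʳ (f n) ⟩
  f n             ∎
  where open ≡-Reasoning

-- Reduces a division to a multiplication: an identity with `recip h` is proved by multiplying by
-- `h`, with no formula for the coefficients of the reciprocal.
⊗-recip : ∀ f g h → h 0 ≡ 1ℤ → (∀ n → (g ⊗ h) n ≡ f n) → ∀ n → (f ⊗ recip h) n ≡ g n
⊗-recip f g h h₀≡1 gh≗f n = begin
  (f ⊗ recip h) n         ≡⟨ ⊗-congˡ (recip h) gh≗f n ⟨
  ((g ⊗ h) ⊗ recip h) n   ≡⟨ ⊗-assoc g h (recip h) n ⟩
  (g ⊗ (h ⊗ recip h)) n   ≡⟨ ⊗-congʳ g (recip-inverse h h₀≡1) n ⟩
  (g ⊗ 𝟏) n               ≡⟨ ⊗-identityʳ g n ⟩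
  g n                     ∎
  where open ≡-Reasoning

-- Partitions into odd parts

weight : List ℕ → ℤ
weight xs = -1ℤ ^ sum (map ⌊_/2⌋ xs)

∑ : List ℤ → ℤ
∑ = foldr _+ℤ_ 0ℤ

∑-++ : ∀ xs ys → ∑ (xs ++ ys) ≡ ∑ xs +ℤ ∑ ys
∑-++ []       ys = sym (ℤ.+-identityˡ (∑ ys))
∑-++ (x ∷ xs) ys = trans (cong (x +ℤ_) (∑-++ xs ys)) (sym (ℤ.+-assoc x (∑ xs) (∑ ys)))

allOdd? : ∀ xs → Dec (All (λ x → ¬ 2 ∣ x) xs)
allOdd? = all? (λ x → ¬? (2 ∣? x))

oddWeight : List (List ℕ) → ℤ
oddWeight = ∑ ∘ map weight ∘ filter allOdd?

oddWeight-++ : ∀ xss yss → oddWeight (xss ++ yss) ≡ oddWeight xss +ℤ oddWeight yss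
oddWeight-++ xss yss = trans
  (cong ∑ (trans (cong (map weight) (filter-++ allOdd? xss yss))
                 (map-++ weight (filter allOdd? xss) (filter allOdd? yss))))
  (∑-++ (map weight (filter allOdd? xss)) (map weight (filter allOdd? yss)))

oddWeight-accept : ∀ {xs} → All (λ x → ¬ 2 ∣ x) xs → ∀ xss →
  oddWeight (xs ∷ xss) ≡ weight xs +ℤ oddWeight xss
oddWeight-accept odd xss = cong (∑ ∘ map weight) (filter-accept allOdd? {xs = xss} odd)

oddWeight-reject : ∀ xs xss → ¬ All (λ x → ¬ 2 ∣ x) xs →
  oddWeight (xs ∷ xss) ≡ oddWeight xss
oddWeight-reject xs xss ¬odd = cong (∑ ∘ map weight) (filter-reject allOdd? {xs = xss} ¬odd)

oddWeight-even∷ : ∀ {m} → 2 ∣ m → ∀ xss → oddWeight (map (m ∷_) xss) ≡ 0ℤ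
oddWeight-even∷     2∣m []         = refl
oddWeight-even∷ {m} 2∣m (xs ∷ xss) = trans
  (oddWeight-reject (m ∷ xs) (map (m ∷_) xss) (λ { (¬2∣m ∷ _) → ¬2∣m 2∣m }))
  (oddWeight-even∷ 2∣m xss)

oddWeight-odd∷ : ∀ {m} → ¬ 2 ∣ m → ∀ xss →
  oddWeight (map (m ∷_) xss) ≡ -1ℤ ^ ⌊ m /2⌋ *ℤ oddWeight xss
oddWeight-odd∷ {m} ¬2∣m []         = sym (ℤ.*-zeroʳ (-1ℤ ^ ⌊ m /2⌋))
oddWeight-odd∷ {m} ¬2∣m (xs ∷ xss) = helper (allOdd? xs)
  where
  open ≡-Reasoning
  c = -1ℤ ^ ⌊ m /2⌋
  helper : Dec (All (λ x → ¬ 2 ∣ x) xs) →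
    oddWeight (map (m ∷_) (xs ∷ xss)) ≡ c *ℤ oddWeight (xs ∷ xss)
  helper (no ¬odd) = begin
    oddWeight (map (m ∷_) (xs ∷ xss))
      ≡⟨ oddWeight-reject (m ∷ xs) (map (m ∷_) xss) (λ { (_ ∷ odd) → ¬odd odd }) ⟩
    oddWeight (map (m ∷_) xss)
      ≡⟨ oddWeight-odd∷ ¬2∣m xss ⟩
    c *ℤ oddWeight xss
      ≡⟨ cong (c *ℤ_) (oddWeight-reject xs xss ¬odd) ⟨
    c *ℤ oddWeight (xs ∷ xss) ∎
  helper (yes odd) = begin
    oddWeight (map (m ∷_) (xs ∷ xss))
      ≡⟨ oddWeight-accept (¬2∣m ∷ odd) (map (m ∷_) xss) ⟩
    weight (m ∷ xs) +ℤ oddWeight (map (m ∷_) xss)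
      ≡⟨ cong₂ _+ℤ_ (ℤ.^-distribˡ-+-* -1ℤ ⌊ m /2⌋ _) (oddWeight-odd∷ ¬2∣m xss) ⟩
    c *ℤ weight xs +ℤ c *ℤ oddWeight xss
      ≡⟨ ℤ.*-distribˡ-+ c (weight xs) (oddWeight xss) ⟨
    c *ℤ (weight xs +ℤ oddWeight xss)
      ≡⟨ cong (c *ℤ_) (oddWeight-accept odd xss) ⟨
    c *ℤ oddWeight (xs ∷ xss) ∎

-- The bound on the number of parts acts as fuel only: parts are positive, so `n` of them always
-- suffice.
boundedPartitions-length : ∀ {l l′} m n → n ≤ l → n ≤ l′ →
  boundedPartitions l m n ≡ boundedPartitions l′ m n
boundedPartitions-length {zero}  {zero}   m zero    _ _ = refl
boundedPartitions-length {zero}  {suc l′} m zero    _ _ = refl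
boundedPartitions-length {suc l} {zero}   m zero    _ _ = refl
boundedPartitions-length {suc l} {suc l′} m zero    _ _ = refl
boundedPartitions-length {suc l} {suc l′} m (suc n) (s≤s n≤l) (s≤s n≤l′) =
  concatMap-cong
    (λ k → cong (map (suc k ∷_))
      (boundedPartitions-length (suc k) (n ∸ k)
        (ℕ.≤-trans (ℕ.m∸n≤m n k) n≤l) (ℕ.≤-trans (ℕ.m∸n≤m n k) n≤l′)))
    (upTo (m ⊓ suc n))

oddPartitionWeight : ℕ → PowerSeries
oddPartitionWeight m n = oddWeight (boundedPartitions n m n)

boundedPartitions-large : ∀ m {l n} → n ≤ m →
  boundedPartitions l (suc m) n ≡ boundedPartitions l m n
boundedPartitions-large m {zero}  {zero}  _   = refl
boundedPartitions-large m {suc l} {zero}  _   = refl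
boundedPartitions-large m {zero}  {suc n} _   = refl
boundedPartitions-large m {suc l} {suc n} n<m
  rewrite ℕ.m≥n⇒m⊓n≡n n<m | ℕ.m≥n⇒m⊓n≡n (ℕ.<⇒≤ n<m) = refl

-- First parts are listed in increasing order, so those equal to `suc m` come last, each followed by
-- a partition of the remaining `j` in which `suc m` may occur again. Writing the total as
-- `j + suc m` keeps truncated subtraction out of the recurrence.
boundedPartitions-suc : ∀ l m j →
  boundedPartitions (suc l) (suc m) (j + suc m) ≡
  boundedPartitions (suc l) m (j + suc m) ++ map (suc m ∷_) (boundedPartitions l (suc m) j)
boundedPartitions-suc l m j rewrite ℕ.+-suc j m
  | ℕ.m≤n⇒m⊓n≡m (ℕ.m≤n+m m j) | ℕ.m≤n⇒m⊓n≡m (ℕ.m≤n⇒m≤1+n (ℕ.m≤n+m m j)) = begin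
  concatMap f (upTo (suc m))
    ≡⟨ cong (concatMap f) (upTo-∷ʳ m) ⟨
  concatMap f (upTo m ++ [ m ])
    ≡⟨ concatMap-++ f (upTo m) [ m ] ⟩
  concatMap f (upTo m) ++ f m ++ []
    ≡⟨ cong (concatMap f (upTo m) ++_) (++-identityʳ (f m)) ⟩
  concatMap f (upTo m) ++ f m
    ≡⟨ cong (λ k → concatMap f (upTo m) ++ map (suc m ∷_) (boundedPartitions l (suc m) k))
         (ℕ.m+n∸n≡m j m) ⟩
  concatMap f (upTo m) ++ map (suc m ∷_) (boundedPartitions l (suc m) j) ∎
  where
  open ≡-Reasoning
  f = λ k → map (suc k ∷_) (boundedPartitions l (suc k) (j + m ∸ k))

oddPartitionWeight-large : ∀ {m n} → n ≤ m → oddPartitionWeight m n ≡ oddPartitionWeight n n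
oddPartitionWeight-large n≤m = helper (ℕ.≤⇒≤′ n≤m)
  where
  helper : ∀ {m n} → n ≤′ m → oddPartitionWeight m n ≡ oddPartitionWeight n n
  helper (≤′-reflexive refl) = refl
  helper (≤′-step {m} n≤′m)    =
    trans (cong oddWeight (boundedPartitions-large m (ℕ.≤′⇒≤ n≤′m))) (helper n≤′m)

oddPartitionWeight-suc : ∀ m j → oddPartitionWeight (suc m) (j + suc m) ≡
  oddPartitionWeight m (j + suc m) +ℤ oddWeight (map (suc m ∷_) (boundedPartitions j (suc m) j))
oddPartitionWeight-suc m j = begin
  oddWeight (boundedPartitions (j + suc m) (suc m) (j + suc m))
    ≡⟨ cong oddWeight (boundedPartitions-length (suc m) (j + suc m) ℕ.≤-refl j+1+m≤1+j+m) ⟩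
  oddWeight (boundedPartitions (suc (j + m)) (suc m) (j + suc m))
    ≡⟨ cong oddWeight (boundedPartitions-suc (j + m) m j) ⟩
  oddWeight (boundedPartitions (suc (j + m)) m (j + suc m) ++
    map (suc m ∷_) (boundedPartitions (j + m) (suc m) j))
    ≡⟨ oddWeight-++ (boundedPartitions (suc (j + m)) m (j + suc m)) _ ⟩
  oddWeight (boundedPartitions (suc (j + m)) m (j + suc m)) +ℤ
    oddWeight (map (suc m ∷_) (boundedPartitions (j + m) (suc m) j))
    ≡⟨ cong₂ (λ xss yss → oddWeight xss +ℤ oddWeight (map (suc m ∷_) yss))
         (boundedPartitions-length m (j + suc m) j+1+m≤1+j+m ℕ.≤-refl)
         (boundedPartitions-length (suc m) j (ℕ.m≤m+n j m) ℕ.≤-refl) ⟩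
  oddPartitionWeight m (j + suc m) +ℤ
    oddWeight (map (suc m ∷_) (boundedPartitions j (suc m) j)) ∎
  where
  open ≡-Reasoning
  j+1+m≤1+j+m = ℕ.≤-reflexive (ℕ.+-suc j m)

m≤n⇒∃[o]o+m≡n : ∀ {m n} → m ≤ n → ∃[ o ] o + m ≡ n
m≤n⇒∃[o]o+m≡n m≤n = _ , ℕ.m∸n+n≡m m≤n

oddPartitionWeight-< : ∀ m {n} → n < suc m →
  oddPartitionWeight (suc m) n ≡ oddPartitionWeight m n
oddPartitionWeight-< m (s≤s n≤m) = cong oddWeight (boundedPartitions-large m n≤m)

oddPartitionWeight-even : ∀ {m} → 2 ∣ suc m → ∀ n →
  oddPartitionWeight (suc m) n ≡ oddPartitionWeight m n
oddPartitionWeight-even {m} 2∣1+m n with n ℕ.<? suc m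
... | yes n<1+m = oddPartitionWeight-< m n<1+m
... | no  n≮1+m with j , refl ← m≤n⇒∃[o]o+m≡n (ℕ.≮⇒≥ n≮1+m) = begin
  oddPartitionWeight (suc m) (j + suc m)
    ≡⟨ oddPartitionWeight-suc m j ⟩
  oddPartitionWeight m (j + suc m) +ℤ oddWeight (map (suc m ∷_) (boundedPartitions j (suc m) j))
    ≡⟨ cong (oddPartitionWeight m (j + suc m) +ℤ_)
         (oddWeight-even∷ 2∣1+m (boundedPartitions j (suc m) j)) ⟩
  oddPartitionWeight m (j + suc m) +ℤ 0ℤ
    ≡⟨ ℤ.+-identityʳ _ ⟩
  oddPartitionWeight m (j + suc m) ∎
  where open ≡-Reasoning

-- The recurrence A_(m+1) = A_m + c q^(m+1) A_(m+1), solved for A_m; removing one copy of the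
-- largest part m+1 costs its weight c.
oddPartitionWeight-odd : ∀ {m} → ¬ 2 ∣ suc m → ∀ n →
  (oddPartitionWeight (suc m) ⊗ (𝟏 ⊕ (- -1ℤ ^ ⌊ suc m /2⌋) q^ suc m)) n ≡ oddPartitionWeight m n
oddPartitionWeight-odd {m} ¬2∣1+m n = begin
  (A ⊗ (𝟏 ⊕ (- c) q^ suc m)) n
    ≡⟨ ⊗-distribˡ-⊕ A 𝟏 ((- c) q^ suc m) n ⟩
  (A ⊗ 𝟏) n +ℤ (A ⊗ (- c) q^ suc m) n
    ≡⟨ cong (_+ℤ (A ⊗ (- c) q^ suc m) n) (⊗-identityʳ A n) ⟩
  A n +ℤ (A ⊗ (- c) q^ suc m) n
    ≡⟨ helper (n ℕ.<? suc m) ⟩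
  oddPartitionWeight m n ∎
  where
  open ≡-Reasoning
  A = oddPartitionWeight (suc m)
  c = -1ℤ ^ ⌊ suc m /2⌋
  helper : Dec (n < suc m) → A n +ℤ (A ⊗ (- c) q^ suc m) n ≡ oddPartitionWeight m n
  helper (yes n<1+m) = trans
    (cong₂ _+ℤ_ (oddPartitionWeight-< m n<1+m) (⊗-q^-< A (- c) n<1+m)) (ℤ.+-identityʳ _)
  helper (no n≮1+m) with j , refl ← m≤n⇒∃[o]o+m≡n (ℕ.≮⇒≥ n≮1+m) = begin
    A (j + suc m) +ℤ (A ⊗ (- c) q^ suc m) (j + suc m)
      ≡⟨ cong₂ _+ℤ_
           (trans (oddPartitionWeight-suc m j)
             (cong (oddPartitionWeight m (j + suc m) +ℤ_)
               (oddWeight-odd∷ ¬2∣1+m (boundedPartitions j (suc m) j))))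
           (⊗-q^-+ A (- c) (suc m) j) ⟩
    (oddPartitionWeight m (j + suc m) +ℤ c *ℤ A j) +ℤ A j *ℤ (- c)
      ≡⟨ solve 3 (λ a b c → (a :+ c :* b) :+ b :* (:- c) := a) refl
           (oddPartitionWeight m (j + suc m)) (A j) c ⟩
    oddPartitionWeight m (j + suc m) ∎
    where open ℤ-Solver

oddFactor : ℕ → PowerSeries
oddFactor n = recip (𝟏 ⊕ (-1ℤ ^ n) q^ (2 * n ∸ 1))

⌊1+2n/2⌋≡n : ∀ n → ⌊ suc (2 * n) /2⌋ ≡ n
⌊1+2n/2⌋≡n n = trans (cong (λ m → ⌊ suc (n + m) /2⌋) (ℕ.+-identityʳ n)) (sym (ℕ.n≡⌈n+n/2⌉ n))

-- Raising `N` by one raises the bound on the parts by two: the odd part 2N+1 accounts for the new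
-- factor, and the even part 2N+2 changes nothing.
partialProduct-oddFactor : ∀ N n → partialProduct oddFactor N n ≡ oddPartitionWeight (2 * N) n
partialProduct-oddFactor zero    zero    = refl
partialProduct-oddFactor zero    (suc n) = refl
partialProduct-oddFactor (suc N) n = begin
  (partialProduct oddFactor N ⊗ oddFactor (suc N)) n
    ≡⟨ ⊗-congˡ (oddFactor (suc N)) (partialProduct-oddFactor N) n ⟩
  (oddPartitionWeight (2 * N) ⊗ oddFactor (suc N)) n
    ≡⟨ cong (λ d → (oddPartitionWeight (2 * N) ⊗ recip (𝟏 ⊕ (-1ℤ ^ suc N) q^ d)) n)
         (cong (_∸ 1) (ℕ.*-suc 2 N)) ⟩
  (oddPartitionWeight (2 * N) ⊗ recip (𝟏 ⊕ (-1ℤ ^ suc N) q^ suc (2 * N))) n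
    ≡⟨ ⊗-recip (oddPartitionWeight (2 * N)) (oddPartitionWeight (suc (2 * N)))
         (𝟏 ⊕ (-1ℤ ^ suc N) q^ suc (2 * N)) refl inverse n ⟩
  oddPartitionWeight (suc (2 * N)) n
    ≡⟨ oddPartitionWeight-even (divides (suc N) (trans (sym (ℕ.*-suc 2 N)) (ℕ.*-comm 2 (suc N)))) n ⟨
  oddPartitionWeight (2 + 2 * N) n
    ≡⟨ cong (λ m → oddPartitionWeight m n) (ℕ.*-suc 2 N) ⟨
  oddPartitionWeight (2 * suc N) n ∎
  where
  open ≡-Reasoning
  ¬2∣1+2N : ¬ 2 ∣ suc (2 * N)
  ¬2∣1+2N 2∣1+2N with () ← ∣1⇒≡1 (∣m+n∣m⇒∣n (subst (2 ∣_) (ℕ.+-comm 1 (2 * N)) 2∣1+2N) (m∣m*n N))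
  -- The part 2N+1 has weight (-1)^N; the minus sign in 1 - c q^(2N+1) makes it the (-1)^(N+1) of
  -- the factor with index N+1.
  sign : - -1ℤ ^ ⌊ suc (2 * N) /2⌋ ≡ -1ℤ ^ suc N
  sign = trans (cong (λ m → - -1ℤ ^ m) (⌊1+2n/2⌋≡n N)) (sym (ℤ.-1*i≡-i (-1ℤ ^ N)))
  inverse : ∀ k → (oddPartitionWeight (suc (2 * N)) ⊗ (𝟏 ⊕ (-1ℤ ^ suc N) q^ suc (2 * N))) k ≡
                  oddPartitionWeight (2 * N) k
  inverse k = trans
    (cong (λ c → (oddPartitionWeight (suc (2 * N)) ⊗ (𝟏 ⊕ c q^ suc (2 * N))) k) (sym sign))
    (oddPartitionWeight-odd ¬2∣1+2N k)

-- A partition of `k` has no part above `k`, and k ≤ N ≤ 2N, so `k` factors already settle the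
-- coefficient of q^k.
partialProduct-stable : ∀ {N k} → k ≤ N → partialProduct oddFactor N k ≡ oddPartitionWeight k k
partialProduct-stable {N} {k} k≤N = trans
  (partialProduct-oddFactor N k)
  (oddPartitionWeight-large (ℕ.≤-trans k≤N (ℕ.m≤m+n N _)))

-- Graphs of maximal degree 2

module _ {A B : Set} where
  concatMap-↭ : (f : A → List B) → ∀ {xs ys} → xs ↭ ys → concatMap f xs ↭ concatMap f ys
  concatMap-↭ f ↭.refl          = ↭-refl
  concatMap-↭ f (prep x p)      = ++⁺ˡ (f x) (concatMap-↭ f p)
  concatMap-↭ f (swap x y p)    =
    ↭-trans (shifts (f x) (f y)) (++⁺ˡ (f y) (++⁺ˡ (f x) (concatMap-↭ f p)))
  concatMap-↭ f (↭.trans p₁ p₂) = ↭-trans (concatMap-↭ f p₁) (concatMap-↭ f p₂)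

module _ {A : Set} where
  ++-cancelˡ-↭ : ∀ (xs : List A) {ys zs} → xs ++ ys ↭ xs ++ zs → ys ↭ zs
  ++-cancelˡ-↭ []       p = p
  ++-cancelˡ-↭ (x ∷ xs) p = ++-cancelˡ-↭ xs (drop-∷ p)

  ∈⇒↭∷ : ∀ {x : A} {xs} → x ∈ xs → ∃[ ys ] xs ↭ x ∷ ys
  ∈⇒↭∷ x∈xs with ls , rs , refl ← ∈-∃++ x∈xs = ls ++ rs , shift _ ls rs

  Unique-++-disjoint : ∀ {x : A} xs {ys} → Unique (xs ++ ys) → x ∈ xs → ¬ x ∈ ys
  Unique-++-disjoint (x ∷ xs) (x∉ ∷ _) (here refl) x∈ys = All.lookup x∉ (∈-++⁺ʳ xs x∈ys) refl
  Unique-++-disjoint (x ∷ xs) (_ ∷ u)  (there x∈xs)  x∈ys = Unique-++-disjoint xs u x∈xs x∈ys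

  Unique-resp-↭ : ∀ {xs ys : List A} → xs ↭ ys → Unique xs → Unique ys
  Unique-resp-↭ p = Permutation.Unique-resp-↭ (≡.setoid A) (↭⇒↭ₛ p)

-- A vertex occurs here as often as its degree, so statements about degrees become permutations of
-- lists.
ends : List Edge → List ℕ
ends = concatMap (λ (u , v) → u ∷ v ∷ [])

ends-++ : ∀ xs ys → ends (xs ++ ys) ≡ ends xs ++ ends ys
ends-++ = concatMap-++ _

edge-comm : ∀ u v → edge u v ≡ edge v u
edge-comm u v = cong₂ _,_ (ℕ.⊓-comm u v) (ℕ.⊔-comm u v)

edge-≤ : ∀ {u v} → u ≤ v → edge u v ≡ (u , v)
edge-≤ u≤v = cong₂ _,_ (ℕ.m≤n⇒m⊓n≡m u≤v) (ℕ.m≤n⇒m⊔n≡n u≤v)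

ends-edge : ∀ u v → ends [ edge u v ] ↭ u ∷ v ∷ []
ends-edge u v with ℕ.≤-total u v
... | inj₁ u≤v = ↭-reflexive (cong (λ e → ends [ e ]) (edge-≤ u≤v))
... | inj₂ v≤u = ↭-trans
  (↭-reflexive (cong (λ e → ends [ e ]) (trans (edge-comm u v) (edge-≤ v≤u))))
  (↭-swap v u ↭-refl)

ends-edge∷ : ∀ u v es → ends (edge u v ∷ es) ↭ u ∷ v ∷ ends es
ends-edge∷ u v es = ++⁺ʳ (ends es) (ends-edge u v)

∈-ends : ∀ {e es} → e ∈ es → proj₁ e ∈ ends es × proj₂ e ∈ ends es
∈-ends e∈es = ∈-concat⁺′ (here refl) (∈-map⁺ _ e∈es) ,
              ∈-concat⁺′ (there (here refl)) (∈-map⁺ _ e∈es)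

pathEdges-++ : ∀ xs y zs → pathEdges (xs ++ y ∷ zs) ≡ pathEdges (xs ∷ʳ y) ++ pathEdges (y ∷ zs)
pathEdges-++ []            y zs = refl
pathEdges-++ (x ∷ [])      y zs = refl
pathEdges-++ (x ∷ x′ ∷ xs) y zs = cong (edge x x′ ∷_) (pathEdges-++ (x′ ∷ xs) y zs)

pathEdges-reverse : ∀ xs → pathEdges (reverse xs) ↭ pathEdges xs
pathEdges-reverse []           = ↭-refl
pathEdges-reverse (x ∷ [])     = ↭-refl
pathEdges-reverse (x ∷ y ∷ xs) = begin
  pathEdges (reverse (x ∷ y ∷ xs))
    ≡⟨ cong pathEdges (reverse-++ (x ∷ y ∷ []) xs) ⟩
  pathEdges (reverse xs ++ y ∷ x ∷ [])
    ≡⟨ pathEdges-++ (reverse xs) y [ x ] ⟩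
  pathEdges (reverse xs ∷ʳ y) ++ [ edge y x ]
    ≡⟨ cong₂ (λ zs e → pathEdges zs ++ [ e ]) (sym (unfold-reverse y xs)) (edge-comm y x) ⟩
  pathEdges (reverse (y ∷ xs)) ++ [ edge x y ]
    ↭⟨ ∷↭∷ʳ (edge x y) _ ⟨
  edge x y ∷ pathEdges (reverse (y ∷ xs))
    ↭⟨ prep (edge x y) (pathEdges-reverse (y ∷ xs)) ⟩
  edge x y ∷ pathEdges (y ∷ xs) ∎
  where open PermutationReasoning

lastOr : ℕ → List ℕ → ℕ
lastOr x []       = x
lastOr x (y ∷ ys) = lastOr y ys

lastOr-∷ʳ : ∀ x ys z → lastOr x (ys ∷ʳ z) ≡ z
lastOr-∷ʳ x []       z = refl
lastOr-∷ʳ x (y ∷ ys) z = lastOr-∷ʳ y ys z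

reverse-lastOr : ∀ x xs → ∃[ ys ] (reverse (x ∷ xs) ≡ lastOr x xs ∷ ys × lastOr (lastOr x xs) ys ≡ x)
reverse-lastOr x []       = [] , refl , refl
reverse-lastOr x (y ∷ xs) with zs , eq , _ ← reverse-lastOr y xs =
  zs ∷ʳ x , trans (unfold-reverse x (y ∷ xs)) (cong (_∷ʳ x) eq) , lastOr-∷ʳ (lastOr y xs) zs x

pathEdges-∷ʳ : ∀ x xs y → pathEdges (x ∷ xs ∷ʳ y) ≡ pathEdges (x ∷ xs) ∷ʳ edge (lastOr x xs) y
pathEdges-∷ʳ x []        y = refl
pathEdges-∷ʳ x (x′ ∷ xs) y = cong (edge x x′ ∷_) (pathEdges-∷ʳ x′ xs y)

-- Inner vertices have degree 2 and the two ends degree 1, or 0 if the path is a single vertex,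
-- which is then both ends; listing the ends once more brings every vertex to 2.
ends-pathEdges : ∀ x xs →
  ends (pathEdges (x ∷ xs)) ++ x ∷ lastOr x xs ∷ [] ↭ (x ∷ xs) ++ (x ∷ xs)
ends-pathEdges x []       = ↭-refl
ends-pathEdges x (y ∷ ys) = begin
  ends (edge x y ∷ es) ++ x ∷ l ∷ []
    ↭⟨ ++⁺ʳ (x ∷ l ∷ []) (ends-edge∷ x y es) ⟩
  x ∷ y ∷ ends es ++ x ∷ l ∷ []
    ↭⟨ ↭-solve 4 (λ x y e l → x ⊞ (y ⊞ (e ⊞ (x ⊞ l))) ⊜ x ⊞ (x ⊞ (e ⊞ (y ⊞ l))))
         ↭-refl [ x ] [ y ] (ends es) [ l ] ⟩
  x ∷ x ∷ ends es ++ y ∷ l ∷ []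
    ↭⟨ prep x (prep x (ends-pathEdges y ys)) ⟩
  x ∷ x ∷ (y ∷ ys) ++ (y ∷ ys)
    ↭⟨ prep x (shift x (y ∷ ys) (y ∷ ys)) ⟨
  (x ∷ y ∷ ys) ++ (x ∷ y ∷ ys) ∎
  where
  open PermutationReasoning
  es = pathEdges (y ∷ ys)
  l  = lastOr y ys

-- The cycle is treated as the path `x ∷ xs ∷ʳ x` from `x` to `x`. Its count has two surplus copies
-- of `x` on either side, which are cancelled.
ends-cycleEdges : ∀ xs → ends (cycleEdges xs) ↭ xs ++ xs
ends-cycleEdges []       = ↭-refl
ends-cycleEdges (x ∷ xs) = ++-cancelˡ-↭ (x ∷ x ∷ []) (begin
  x ∷ x ∷ ends (pathEdges (x ∷ xs ∷ʳ x))
    ↭⟨ ++-comm (x ∷ x ∷ []) _ ⟩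
  ends (pathEdges (x ∷ xs ∷ʳ x)) ++ x ∷ x ∷ []
    ≡⟨ cong (λ l → ends (pathEdges (x ∷ xs ∷ʳ x)) ++ x ∷ l ∷ []) (lastOr-∷ʳ x xs x) ⟨
  ends (pathEdges (x ∷ xs ∷ʳ x)) ++ x ∷ lastOr x (xs ∷ʳ x) ∷ []
    ↭⟨ ends-pathEdges x (xs ∷ʳ x) ⟩
  (x ∷ xs ∷ʳ x) ++ (x ∷ xs ∷ʳ x)
    ↭⟨ ↭-solve 2 (λ x y → (x ⊞ (y ⊞ x)) ⊞ (x ⊞ (y ⊞ x)) ⊜ x ⊞ (x ⊞ ((x ⊞ y) ⊞ (x ⊞ y))))
         ↭-refl [ x ] xs ⟩
  x ∷ x ∷ (x ∷ xs) ++ (x ∷ xs) ∎)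
  where open PermutationReasoning

-- Decomposition of a graph into explicit paths and cycles

data Strand : Set where
  path cycle : List ℕ → Strand

vertices : Strand → List ℕ
vertices (path xs)  = xs
vertices (cycle xs) = xs

edges : Strand → List Edge
edges (path xs)  = pathEdges xs
edges (cycle xs) = cycleEdges xs

-- The vertices of degree less than 2, an isolated vertex counted twice.
freeEnds : Strand → List ℕ
freeEnds (path (x ∷ xs)) = x ∷ lastOr x xs ∷ []
freeEnds _               = []

ends-edges : ∀ s → ends (edges s) ++ freeEnds s ↭ vertices s ++ vertices s
ends-edges (path [])       = ↭-refl
ends-edges (path (x ∷ xs)) = ends-pathEdges x xs
ends-edges (cycle xs)      = ↭-trans (↭-reflexive (++-identityʳ _)) (ends-cycleEdges xs)

interchange : ∀ (as bs cs ds : List ℕ) → (as ++ bs) ++ (cs ++ ds) ↭ (as ++ cs) ++ (bs ++ ds)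
interchange = ↭-solve 4 (λ a b c d → (a ⊞ b) ⊞ (c ⊞ d) ⊜ (a ⊞ c) ⊞ (b ⊞ d)) ↭-refl

ends-concatMap-edges : ∀ ss → ends (concatMap edges ss) ++ concatMap freeEnds ss ↭
  concatMap vertices ss ++ concatMap vertices ss
ends-concatMap-edges []       = ↭-refl
ends-concatMap-edges (s ∷ ss) = begin
  ends (edges s ++ concatMap edges ss) ++ freeEnds s ++ concatMap freeEnds ss
    ≡⟨ cong (_++ freeEnds s ++ concatMap freeEnds ss) (ends-++ (edges s) (concatMap edges ss)) ⟩
  (ends (edges s) ++ ends (concatMap edges ss)) ++ freeEnds s ++ concatMap freeEnds ss
    ↭⟨ interchange (ends (edges s)) (ends (concatMap edges ss)) (freeEnds s) (concatMap freeEnds ss) ⟩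
  (ends (edges s) ++ freeEnds s) ++ ends (concatMap edges ss) ++ concatMap freeEnds ss
    ↭⟨ ++⁺ (ends-edges s) (ends-concatMap-edges ss) ⟩
  (vertices s ++ vertices s) ++ concatMap vertices ss ++ concatMap vertices ss
    ↭⟨ interchange (vertices s) (vertices s) (concatMap vertices ss) (concatMap vertices ss) ⟩
  (vertices s ++ concatMap vertices ss) ++ vertices s ++ concatMap vertices ss ∎
  where
  open PermutationReasoning

-- A path can be read from either side, so each of its free ends may be taken as the first vertex.
freeEnd-first : ∀ s {u} → u ∈ freeEnds s →
  ∃[ ys ] (u ∷ ys ↭ vertices s × pathEdges (u ∷ ys) ↭ edges s × u ∷ lastOr u ys ∷ [] ↭ freeEnds s)
freeEnd-first (path (x ∷ xs)) (here refl)         = xs , ↭-refl , ↭-refl , ↭-refl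
freeEnd-first (path (x ∷ xs)) (there (here refl))
  with ys , eq , last≡x ← reverse-lastOr x xs =
    ys
  , ↭-trans (↭-reflexive (sym eq)) (↭-reverse (x ∷ xs))
  , ↭-trans (↭-reflexive (cong pathEdges (sym eq))) (pathEdges-reverse (x ∷ xs))
  , ↭-trans (↭-reflexive (cong (λ l → lastOr x xs ∷ l ∷ []) last≡x)) (swap _ _ ↭-refl)

find-freeEnd : ∀ ss {u} → u ∈ concatMap freeEnds ss → ∃[ ys ] ∃[ ss′ ]
  ( u ∷ ys ++ concatMap vertices ss′ ↭ concatMap vertices ss
  × pathEdges (u ∷ ys) ++ concatMap edges ss′ ↭ concatMap edges ss
  × u ∷ lastOr u ys ∷ concatMap freeEnds ss′ ↭ concatMap freeEnds ss)
find-freeEnd ss u∈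
  with s , s∈ss , u∈s ← find (∈-concatMap⁻ freeEnds {xs = ss} u∈)
  with ss′ , ss↭ ← ∈⇒↭∷ s∈ss
  with ys , vs↭ , es↭ , fs↭ ← freeEnd-first s u∈s =
    ys , ss′
  , ↭-trans (++⁺ʳ _ vs↭) (↭-sym (concatMap-↭ vertices ss↭))
  , ↭-trans (++⁺ʳ _ es↭) (↭-sym (concatMap-↭ edges ss↭))
  , ↭-trans (++⁺ʳ _ fs↭) (↭-sym (concatMap-↭ freeEnds ss↭))

-- Joining two free ends closes a path into a cycle or merges two paths.
join-freeEnds : ∀ ss {u v zs} → u ∷ v ∷ zs ↭ concatMap freeEnds ss → ∃[ ss′ ]
  ( concatMap vertices ss′ ↭ concatMap vertices ss
  × concatMap edges ss′ ↭ edge u v ∷ concatMap edges ss)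
join-freeEnds ss {u} {v} fs↭
  with ys , ss₁ , vs↭₁ , es↭₁ , fs↭₁ ← find-freeEnd ss (∈-resp-↭ fs↭ (here refl))
  -- With `u` removed, the free ends are the other end of its strand and those of the remaining
  -- strands. Removing one copy only is right also when `u` is isolated, where the other end is `u`
  -- again.
  with ∈-resp-↭ (drop-∷ (↭-trans fs↭ (↭-sym fs↭₁))) (here refl)
... | here v≡last = cycle (u ∷ ys) ∷ ss₁ , vs↭₁ , (begin
  pathEdges (u ∷ ys ∷ʳ u) ++ concatMap edges ss₁
    ≡⟨ cong (_++ concatMap edges ss₁) (pathEdges-∷ʳ u ys u) ⟩
  (pathEdges (u ∷ ys) ∷ʳ edge (lastOr u ys) u) ++ concatMap edges ss₁
    ↭⟨ ++⁺ʳ (concatMap edges ss₁) (∷↭∷ʳ (edge (lastOr u ys) u) (pathEdges (u ∷ ys))) ⟨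
  edge (lastOr u ys) u ∷ pathEdges (u ∷ ys) ++ concatMap edges ss₁
    ≡⟨ cong (_∷ pathEdges (u ∷ ys) ++ concatMap edges ss₁)
         (trans (cong (λ l → edge l u) (sym v≡last)) (edge-comm v u)) ⟩
  edge u v ∷ pathEdges (u ∷ ys) ++ concatMap edges ss₁
    ↭⟨ prep (edge u v) es↭₁ ⟩
  edge u v ∷ concatMap edges ss ∎)
  where open PermutationReasoning
-- The path of `u` is reversed so that it ends in `u`; the path of `v` starts with `v`, and the new
-- edge links the two.
... | there v∈
  with zs , ss₂ , vs↭₂ , es↭₂ , _ ← find-freeEnd ss₁ v∈ =
  path (reverse ys ++ u ∷ v ∷ zs) ∷ ss₂ , (begin
  (reverse ys ++ u ∷ v ∷ zs) ++ concatMap vertices ss₂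
    ↭⟨ ++⁺ʳ (concatMap vertices ss₂) (++⁺ʳ (u ∷ v ∷ zs) (↭-reverse ys)) ⟩
  (ys ++ u ∷ v ∷ zs) ++ concatMap vertices ss₂
    ↭⟨ ↭-solve 4 (λ u y z w → (y ⊞ (u ⊞ z)) ⊞ w ⊜ u ⊞ (y ⊞ (z ⊞ w)))
         ↭-refl [ u ] ys (v ∷ zs) (concatMap vertices ss₂) ⟩
  u ∷ ys ++ (v ∷ zs ++ concatMap vertices ss₂)
    ↭⟨ ++⁺ˡ (u ∷ ys) vs↭₂ ⟩
  u ∷ ys ++ concatMap vertices ss₁
    ↭⟨ vs↭₁ ⟩
  concatMap vertices ss ∎) , (begin
  pathEdges (reverse ys ++ u ∷ v ∷ zs) ++ Q
    ≡⟨ cong (_++ Q) (pathEdges-++ (reverse ys) u (v ∷ zs)) ⟩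
  (pathEdges (reverse ys ∷ʳ u) ++ edge u v ∷ pathEdges (v ∷ zs)) ++ Q
    ≡⟨ cong (λ xs → (pathEdges xs ++ edge u v ∷ pathEdges (v ∷ zs)) ++ Q) (unfold-reverse u ys) ⟨
  (pathEdges (reverse (u ∷ ys)) ++ edge u v ∷ pathEdges (v ∷ zs)) ++ Q
    ↭⟨ ++⁺ʳ Q (++⁺ʳ (edge u v ∷ pathEdges (v ∷ zs)) (pathEdges-reverse (u ∷ ys))) ⟩
  (pathEdges (u ∷ ys) ++ edge u v ∷ pathEdges (v ∷ zs)) ++ Q
    ↭⟨ ++⁺ʳ Q (shift (edge u v) (pathEdges (u ∷ ys)) (pathEdges (v ∷ zs))) ⟩
  edge u v ∷ (pathEdges (u ∷ ys) ++ pathEdges (v ∷ zs)) ++ Q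
    ↭⟨ prep (edge u v) (++-assoc (pathEdges (u ∷ ys)) (pathEdges (v ∷ zs)) Q) ⟩
  edge u v ∷ pathEdges (u ∷ ys) ++ pathEdges (v ∷ zs) ++ Q
    ↭⟨ prep (edge u v) (++⁺ˡ (pathEdges (u ∷ ys)) es↭₂) ⟩
  edge u v ∷ pathEdges (u ∷ ys) ++ concatMap edges ss₁
    ↭⟨ prep (edge u v) es↭₁ ⟩
  edge u v ∷ concatMap edges ss ∎)
  where
  open PermutationReasoning
  Q = concatMap edges ss₂

-- Both lists complete the same edge ends to two copies of every vertex, so they agree by
-- cancellation. This turns the degree bound into the fact that the ends of the next edge are free.
freeEnds-unique : ∀ ss {vs es zs} → concatMap vertices ss ↭ vs → concatMap edges ss ↭ es →
  ends es ++ zs ↭ vs ++ vs → zs ↭ concatMap freeEnds ss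
freeEnds-unique ss {vs} {es} {zs} vs↭ es↭ ends↭ = ++-cancelˡ-↭ (ends es) (begin
  ends es ++ zs
    ↭⟨ ends↭ ⟩
  vs ++ vs
    ↭⟨ ++⁺ vs↭ vs↭ ⟨
  concatMap vertices ss ++ concatMap vertices ss
    ↭⟨ ends-concatMap-edges ss ⟨
  ends (concatMap edges ss) ++ concatMap freeEnds ss
    ↭⟨ ++⁺ʳ (concatMap freeEnds ss) (concatMap-↭ _ es↭) ⟩
  ends es ++ concatMap freeEnds ss ∎)
  where open PermutationReasoning

-- Every edge produced by `pathEdges` has its smaller end first, so only a list of such pairs can be
-- matched literally.
Ordered : Edge → Set
Ordered (u , v) = u ≤ v

-- The hypothesis says that every vertex has degree at most 2: zs makes up for
-- the missing edge ends.
strands : ∀ {es} → All Ordered es → ∀ {vs zs} → ends es ++ zs ↭ vs ++ vs →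
  ∃[ ss ] (concatMap vertices ss ↭ vs × concatMap edges ss ↭ es)
strands [] {vs} _ =
  map (path ∘ [_]) vs , ↭-reflexive (vertices-singletons vs) , ↭-reflexive (edges-singletons vs)
  where
  vertices-singletons : ∀ vs → concatMap vertices (map (path ∘ [_]) vs) ≡ vs
  vertices-singletons []       = refl
  vertices-singletons (v ∷ vs) = cong (v ∷_) (vertices-singletons vs)
  edges-singletons : ∀ vs → concatMap edges (map (path ∘ [_]) vs) ≡ []
  edges-singletons []       = refl
  edges-singletons (v ∷ vs) = edges-singletons vs
strands {(u , v) ∷ es} (u≤v ∷ ord) {vs} {zs} ends↭
  -- Without the edge (u , v) its two ends are missing ends, so they move into the padding for the
  -- induction hypothesis.
  with ends↭′ ← ↭-trans (shifts (ends es) (u ∷ v ∷ [])) ends↭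
  with ss , vs↭ , es↭ ← strands ord ends↭′
  with ss′ , vs↭′ , es↭′ ← join-freeEnds ss (freeEnds-unique ss vs↭ es↭ ends↭′)
  = ss′ , ↭-trans vs↭′ vs↭ ,
    ↭-trans es↭′ (↭-trans (prep (edge u v) es↭) (↭-reflexive (cong (_∷ es) (edge-≤ u≤v))))

-- Connected components as strands

connected-edge : ∀ {es u v} → edge u v ∈ es → Connected es u v
connected-edge {es} {u} {v} e∈es with ℕ.≤-total u v
... | inj₁ u≤v = EqClosure.return (subst (_∈ es) (edge-≤ u≤v) e∈es)
... | inj₂ v≤u = EqClosure.symmetric _
  (EqClosure.return (subst (_∈ es) (trans (edge-comm u v) (edge-≤ v≤u)) e∈es))

connected-head : ∀ x xs {v} → v ∈ x ∷ xs → Connected (pathEdges (x ∷ xs)) x v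
connected-head x xs       (here refl) = ε
connected-head x (y ∷ xs) (there v∈)    =
  connected-edge (here refl) ◅◅ EqClosure.map there (connected-head y xs v∈)

connected-pathEdges : ∀ xs {u v} → u ∈ xs → v ∈ xs → Connected (pathEdges xs) u v
connected-pathEdges (x ∷ xs) u∈ v∈ =
  EqClosure.symmetric _ (connected-head x xs u∈) ◅◅ connected-head x xs v∈

connected-edges : ∀ s {u v} → u ∈ vertices s → v ∈ vertices s → Connected (edges s) u v
connected-edges (path xs)        u∈ v∈ = connected-pathEdges xs u∈ v∈
connected-edges (cycle (x ∷ xs)) u∈ v∈ =
  connected-pathEdges (x ∷ xs ∷ʳ x) (∈-++⁺ˡ u∈) (∈-++⁺ˡ v∈)

-- With `P` taken as membership in one strand, this shows that no walk leaves a strand.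
connected-closed : ∀ {es} {P : ℕ → Set} → All (λ (u , v) → (P u → P v) × (P v → P u)) es →
  ∀ {u v} → Connected es u v → P u → P v
connected-closed closed ε              pu = pu
connected-closed closed (fwd e∈es ◅ c) pu =
  connected-closed closed c (proj₁ (All.lookup closed e∈es) pu)
connected-closed closed (bwd e∈es ◅ c) pu =
  connected-closed closed c (proj₂ (All.lookup closed e∈es) pu)

ends⊆vertices : ∀ ss {e} → e ∈ concatMap edges ss →
  proj₁ e ∈ concatMap vertices ss × proj₂ e ∈ concatMap vertices ss
ends⊆vertices ss e∈ = let u∈ , v∈ = ∈-ends e∈ in ∈vertices u∈ , ∈vertices v∈
  where
  ∈vertices : ∀ {u} → u ∈ ends (concatMap edges ss) → u ∈ concatMap vertices ss
  ∈vertices u∈ with ∈-++⁻ (concatMap vertices ss)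
    (∈-resp-↭ (ends-concatMap-edges ss) (∈-++⁺ˡ u∈))
  ... | inj₁ u∈vs = u∈vs
  ... | inj₂ u∈vs = u∈vs

module _ (s : Strand) (ss : List Strand) {es : List Edge} {n : ℕ}
  (vs↭ : vertices s ++ concatMap vertices ss ↭ upTo n)
  (es↭ : edges s ++ concatMap edges ss ↭ es) where

  private
    -- The strands together list `upTo n`, which has no repetitions.
    disjoint : ∀ {v} → v ∈ vertices s → ¬ v ∈ concatMap vertices ss
    disjoint = Unique-++-disjoint (vertices s) (Unique-resp-↭ (↭-sym vs↭) (Unique.upTo⁺ n))

    ends⊆vertices₁ : ∀ {e} → e ∈ edges s → proj₁ e ∈ vertices s × proj₂ e ∈ vertices s
    ends⊆vertices₁ e∈ with u∈ , v∈ ← ends⊆vertices [ s ] (∈-++⁺ˡ e∈) =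
      subst (_ ∈_) (++-identityʳ _) u∈ , subst (_ ∈_) (++-identityʳ _) v∈

    closed : All (λ (u , v) → (u ∈ vertices s → v ∈ vertices s) × (v ∈ vertices s → u ∈ vertices s)) es
    closed = All-resp-↭ es↭ (All.++⁺
      (All.tabulate (λ e∈ → let u∈ , v∈ = ends⊆vertices₁ e∈ in (λ _ → v∈) , (λ _ → u∈)))
      (All.tabulate (λ e∈ → let u∈ , v∈ = ends⊆vertices ss e∈ in
        (λ u∈s → contradiction u∈ (disjoint u∈s)) , (λ v∈s → contradiction v∈ (disjoint v∈s)))))

    inside : ∀ {u v} → u ∈ vertices s → v ∈ vertices s → Connected es u v
    inside u∈ v∈ = EqClosure.map (λ e∈ → ∈-resp-↭ es↭ (∈-++⁺ˡ e∈)) (connected-edges s u∈ v∈)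

    outside : ∀ {u v} → u ∈ vertices s → v ∈ concatMap vertices ss → ¬ Connected es u v
    outside u∈ v∈ c = disjoint (connected-closed closed c u∈) v∈

  -- Filtering by connectedness to `u` keeps the whole strand of `u` and nothing of the others.
  componentOf-vertices : ∀ {u} → u ∈ vertices s →
    vertices s ↭ Component.vertices (componentOf (multigraph n es) u)
  componentOf-vertices {u} u∈ = begin
    vertices s
      ≡⟨ ++-identityʳ _ ⟨
    vertices s ++ []
      ≡⟨ cong₂ _++_ (filter-all (connected? es u) (All.tabulate (inside u∈)))
           (filter-none (connected? es u) (All.tabulate (outside u∈))) ⟨
    filter (connected? es u) (vertices s) ++ filter (connected? es u) (concatMap vertices ss)
      ≡⟨ filter-++ (connected? es u) (vertices s) _ ⟨
    filter (connected? es u) (vertices s ++ concatMap vertices ss)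
      ↭⟨ filter-↭ (connected? es u) vs↭ ⟩
    filter (connected? es u) (upTo n) ∎
    where open PermutationReasoning

  componentOf-edges : ∀ {u} → u ∈ vertices s →
    edges s ↭ Component.edges (componentOf (multigraph n es) u)
  componentOf-edges {u} u∈ = begin
    edges s
      ≡⟨ ++-identityʳ _ ⟨
    edges s ++ []
      ≡⟨ cong₂ _++_
           (filter-all u? (All.tabulate (λ e∈ → inside u∈ (proj₁ (ends⊆vertices₁ e∈)))))
           (filter-none u? (All.tabulate (λ e∈ → outside u∈ (proj₁ (ends⊆vertices ss e∈))))) ⟨
    filter u? (edges s) ++ filter u? (concatMap edges ss)
      ≡⟨ filter-++ u? (edges s) _ ⟨
    filter u? (edges s ++ concatMap edges ss)
      ↭⟨ filter-↭ u? es↭ ⟩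
    filter u? es ∎
    where
    open PermutationReasoning
    u? = connected? es u ∘ proj₁

length-pathEdges : ∀ x xs → suc (length (pathEdges (x ∷ xs))) ≡ length (x ∷ xs)
length-pathEdges x []       = refl
length-pathEdges x (y ∷ xs) = cong suc (length-pathEdges y xs)

length-cycleEdges : ∀ xs → length (cycleEdges xs) ≡ length xs
length-cycleEdges []       = refl
length-cycleEdges (x ∷ xs) = begin
  length (pathEdges (x ∷ xs ∷ʳ x))                        ≡⟨ cong length (pathEdges-∷ʳ x xs x) ⟩
  length (pathEdges (x ∷ xs) ∷ʳ edge (lastOr x xs) x)     ≡⟨ length-++ (pathEdges (x ∷ xs)) ⟩
  length (pathEdges (x ∷ xs)) + 1                         ≡⟨ ℕ.+-comm _ 1 ⟩
  suc (length (pathEdges (x ∷ xs)))                       ≡⟨ length-pathEdges x xs ⟩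
  length (x ∷ xs)                                         ∎
  where open ≡-Reasoning

-- The numbers of vertices and edges tell paths and cycles apart.
PathLike CycleLike : Component → Set
PathLike  c = IsPath c × suc (length (Component.edges c)) ≡ length (Component.vertices c)
CycleLike c = ¬ IsPath c × length (Component.edges c) ≡ length (Component.vertices c)

strand-component : ∀ s {u vs es} → u ∈ vertices s → vertices s ↭ vs → edges s ↭ es →
  PathLike (component vs es) ⊎ CycleLike (component vs es)
strand-component (path (x ∷ xs)) u∈ vs↭ es↭ = inj₁ (((x ∷ xs) , vs↭ , es↭) ,
  trans (cong suc (sym (↭-length es↭))) (trans (length-pathEdges x xs) (↭-length vs↭)))
strand-component (cycle xs) {vs = vs} {es} u∈ vs↭ es↭ = inj₂ (notPath , |es|≡|vs|)
  where
  |es|≡|vs| = trans (sym (↭-length es↭)) (trans (length-cycleEdges xs) (↭-length vs↭))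
  notPath : ¬ IsPath (component vs es)
  -- The empty list counts as a path with as many edges as vertices, so lengths cannot exclude it;
  -- the vertex `u` does.
  notPath ([]     , ys↭ , _) with () ← ∈-resp-↭ (↭-trans vs↭ (↭-sym ys↭)) u∈
  notPath (y ∷ ys , ys↭ , es↭′) = ℕ.1+n≢n (begin
    suc (length (pathEdges (y ∷ ys))) ≡⟨ length-pathEdges y ys ⟩
    length (y ∷ ys)                   ≡⟨ ↭-length ys↭ ⟩
    length vs                         ≡⟨ |es|≡|vs| ⟨
    length es                         ≡⟨ ↭-length es↭′ ⟨
    length (pathEdges (y ∷ ys))       ∎)
    where open ≡-Reasoning

-- Counting components

module _ {A : Set} {R : A → A → Set} (R? : ∀ x y → Dec (R x y)) where

  length-filter-∷ : ∀ {B : Set} (f : B → A) x xs ds →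
    sum (map (λ d → length (filter (R? d ∘ f) (x ∷ xs))) ds) ≡
    length (filter (λ d → R? d (f x)) ds) + sum (map (λ d → length (filter (R? d ∘ f) xs)) ds)
  length-filter-∷ f x xs []       = refl
  length-filter-∷ f x xs (d ∷ ds) with R? d (f x)
  ... | yes _ = cong suc (trans
    (cong (length (filter (R? d ∘ f) xs) +_) (length-filter-∷ f x xs ds))
    (x∙yz≈y∙xz (length (filter (R? d ∘ f) xs)) (length (filter (λ d → R? d (f x)) ds)) _))
  ... | no _  = trans
    (cong (length (filter (R? d ∘ f) xs) +_) (length-filter-∷ f x xs ds))
    (x∙yz≈y∙xz (length (filter (R? d ∘ f) xs)) (length (filter (λ d → R? d (f x)) ds)) _)

  length-filter-unique : (∀ {x y z} → R x z → R y z → R x y) →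
    ∀ {ds y} → AllPairs (λ d e → ¬ R d e) ds → Any (λ d → R d y) ds →
    length (filter (λ d → R? d y) ds) ≡ 1
  length-filter-unique euclidean {d ∷ ds} {y} (¬r ∷ _) (here r) = begin
    length (filter (λ d → R? d y) (d ∷ ds)) ≡⟨ cong length (filter-accept (λ d → R? d y) r) ⟩
    suc (length (filter (λ d → R? d y) ds)) ≡⟨ cong (suc ∘ length) (filter-none (λ d → R? d y)
                                                 (All.map (λ ¬r r′ → ¬r (euclidean r r′)) ¬r)) ⟩
    1                                       ∎
    where open ≡-Reasoning
  length-filter-unique euclidean {d ∷ ds} {y} (¬r ∷ ¬rs) (there rs) = trans
    (cong length (filter-reject (λ d → R? d y)
      (λ r → All.lookupWith (λ ¬r r′ → ¬r (euclidean r r′)) ¬r rs)))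
    (length-filter-unique euclidean ¬rs rs)

  -- Double counting of the pairs of a representative and an element related to it: every element
  -- has exactly one representative. Taking `f` as the identity counts vertices, taking it as
  -- `proj₁` counts edges by their first end.
  sum-length-filter : (∀ {x y z} → R x z → R y z → R x y) →
    ∀ {ds} → AllPairs (λ d e → ¬ R d e) ds →
    ∀ {B : Set} (f : B → A) {xs} → All (λ x → Any (λ d → R d (f x)) ds) xs →
    sum (map (λ d → length (filter (R? d ∘ f) xs)) ds) ≡ length xs
  sum-length-filter euclidean {ds} ¬rs f {[]}     []       = sum-zero ds
    where
    sum-zero : ∀ ds → sum (map (λ _ → 0) ds) ≡ 0
    sum-zero []       = refl
    sum-zero (d ∷ ds) = sum-zero ds
  sum-length-filter euclidean {ds} ¬rs f {x ∷ xs} (r ∷ rs) = trans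
    (length-filter-∷ f x xs ds)
    (cong₂ _+_ (length-filter-unique euclidean ¬rs r) (sum-length-filter euclidean ¬rs f rs))

  deduplicate-distinct : ∀ xs → AllPairs (λ x y → ¬ R x y) (deduplicate R? xs)
  deduplicate-distinct []       = []
  deduplicate-distinct (x ∷ xs) =
    All.all-filter (¬? ∘ R? x) (deduplicate R? xs) ∷
    AllPairs.filter⁺ (¬? ∘ R? x) (deduplicate-distinct xs)

-- Vertices minus edges is 1 for a `PathLike` component and 0 for a `CycleLike` one; the edges stand
-- on the left to avoid subtraction in ℕ.
#isPath-+-edges : ∀ (c : ℕ → Component) {ds} → All (λ d → PathLike (c d) ⊎ CycleLike (c d)) ds →
  length (filter isPath? (map c ds)) + sum (map (λ d → length (Component.edges (c d))) ds) ≡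
  sum (map (λ d → length (Component.vertices (c d))) ds)
#isPath-+-edges c []                        = refl
#isPath-+-edges c {d ∷ ds} (inj₁ (isPath , 1+e≡v) ∷ cs) = begin
  length (filter isPath? (c d ∷ map c ds)) + (e + E)
    ≡⟨ cong (λ xs → length xs + (e + E)) (filter-accept isPath? isPath) ⟩
  suc (P + (e + E))
    ≡⟨ cong suc (x∙yz≈y∙xz P e E) ⟩
  suc e + (P + E)
    ≡⟨ cong₂ _+_ 1+e≡v (#isPath-+-edges c cs) ⟩
  sum (map (λ d → length (Component.vertices (c d))) (d ∷ ds)) ∎
  where
  open ≡-Reasoning
  e = length (Component.edges (c d))
  E = sum (map (λ d → length (Component.edges (c d))) ds)
  P = length (filter isPath? (map c ds))
#isPath-+-edges c {d ∷ ds} (inj₂ (¬isPath , e≡v) ∷ cs) = begin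
  length (filter isPath? (c d ∷ map c ds)) + (e + E)
    ≡⟨ cong (λ xs → length xs + (e + E)) (filter-reject isPath? ¬isPath) ⟩
  P + (e + E)
    ≡⟨ x∙yz≈y∙xz P e E ⟩
  e + (P + E)
    ≡⟨ cong₂ _+_ e≡v (#isPath-+-edges c cs) ⟩
  sum (map (λ d → length (Component.vertices (c d))) (d ∷ ds)) ∎
  where
  open ≡-Reasoning
  e = length (Component.edges (c d))
  E = sum (map (λ d → length (Component.edges (c d))) ds)
  P = length (filter isPath? (map c ds))

-- The strands only supply the dichotomy for each component. The count itself runs over the
-- representatives, so no matching of strands with components has to be set up.
#paths-+-edges : ∀ {n es zs} → All Ordered es → ends es ++ zs ↭ upTo n ++ upTo n →
  #paths (multigraph n es) + length es ≡ n
#paths-+-edges {n} {es} ord ends↭ with ss , vs↭ , es↭ ← strands ord ends↭ = begin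
  #paths G + length es
    ≡⟨ cong (#paths G +_) (sum-length-filter (connected? es) euclidean distinct proj₁
         (All.tabulate λ e∈ → covered (end<n e∈))) ⟨
  #paths G + sum (map (λ d → length (Component.edges (componentOf G d))) ds)
    ≡⟨ #isPath-+-edges (componentOf G) (All.deduplicate⁺ (connected? es) (All.tabulate dichotomy)) ⟩
  sum (map (λ d → length (Component.vertices (componentOf G d))) ds)
    ≡⟨ sum-length-filter (connected? es) euclidean distinct (λ v → v) (All.tabulate covered) ⟩
  length (upTo n)
    ≡⟨ length-upTo n ⟩
  n ∎
  where
  open ≡-Reasoning
  G = multigraph n es
  ds = deduplicate (connected? es) (upTo n)
  distinct = deduplicate-distinct (connected? es) (upTo n)
  euclidean : ∀ {x y z} → Connected es x z → Connected es y z → Connected es x y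
  euclidean p q = p ◅◅ EqClosure.symmetric _ q
  covered : ∀ {v} → v ∈ upTo n → Any (λ d → Connected es d v) ds
  covered v∈ = Any.deduplicate⁺ (connected? es) (λ p q → p ◅◅ q) (Any.map (λ { refl → ε }) v∈)
  end<n : ∀ {e} → e ∈ es → proj₁ e ∈ upTo n
  end<n e∈ with ∈-++⁻ (upTo n) (∈-resp-↭ ends↭ (∈-++⁺ˡ (proj₁ (∈-ends e∈))))
  ... | inj₁ v∈ = v∈
  ... | inj₂ v∈ = v∈
  dichotomy : ∀ {v} → v ∈ upTo n → PathLike (componentOf G v) ⊎ CycleLike (componentOf G v)
  dichotomy v∈
    with s , s∈ss , v∈s ← find (∈-concatMap⁻ vertices {xs = ss} (∈-resp-↭ (↭-sym vs↭) v∈))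
    with ss′ , ss↭ ← ∈⇒↭∷ s∈ss =
    strand-component s v∈s
      (componentOf-vertices s ss′ vs↭′ es↭′ v∈s) (componentOf-edges s ss′ vs↭′ es↭′ v∈s)
    where
    vs↭′ = ↭-trans (↭-sym (concatMap-↭ vertices ss↭)) vs↭
    es↭′ = ↭-trans (↭-sym (concatMap-↭ edges ss↭)) es↭

-- Meanders

applyUpTo-cong : ∀ {A : Set} {f g : ℕ → A} → (∀ i → f i ≡ g i) →
  ∀ n → applyUpTo f n ≡ applyUpTo g n
applyUpTo-cong f≗g zero    = refl
applyUpTo-cong f≗g (suc n) = cong₂ _∷_ (f≗g 0) (applyUpTo-cong (f≗g ∘ suc) n)

applyUpTo-+ : ∀ {A : Set} (f : ℕ → A) m n →
  applyUpTo f (m + n) ≡ applyUpTo f m ++ applyUpTo (f ∘ (m +_)) n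
applyUpTo-+ f zero    n = refl
applyUpTo-+ f (suc m) n = cong (f 0 ∷_) (applyUpTo-+ (f ∘ suc) m n)

-- Arcs of a block are nested: below the outermost one lies the block of the `m` inner vertices.
blockArcs-suc : ∀ s m → blockArcs s (2 + m) ≡ edge (s + 0) (s + suc m) ∷ blockArcs (suc s) m
blockArcs-suc s m = cong (edge (s + 0) (s + suc m) ∷_) (begin
  map f (applyUpTo suc ⌊ m /2⌋)  ≡⟨ cong (map f) (map-upTo suc ⌊ m /2⌋) ⟨
  map f (map suc (upTo ⌊ m /2⌋)) ≡⟨ map-∘ (upTo ⌊ m /2⌋) ⟨
  map (f ∘ suc) (upTo ⌊ m /2⌋)   ≡⟨ map-cong-local (All.tabulate (λ {i} i∈ →
                                      cong₂ edge (ℕ.+-suc s i)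
                                        (far (ℕ.<-≤-trans (∈-upTo⁻ i∈) (ℕ.⌊n/2⌋≤n m))))) ⟩
  blockArcs (suc s) m            ∎)
  where
  open ≡-Reasoning
  f = λ j → edge (s + j) (s + (suc m ∸ j))
  -- For i ≥ m truncation breaks the equation, so it is used only on the actual indices, which are
  -- below ⌊m/2⌋ ≤ m.
  far : ∀ {i m} → i < m → s + (m ∸ i) ≡ suc s + (m ∸ 1 ∸ i)
  far {i} {suc m} (s≤s i≤m) = trans (cong (s +_) (ℕ.+-∸-assoc 1 i≤m)) (ℕ.+-suc s (m ∸ i))

-- Each vertex of a block is an end of at most one arc; `zs` is empty or consists of the middle
-- vertex of a block of odd size.
ends-blockArcs : ∀ s m → ∃[ zs ] ends (blockArcs s m) ++ zs ↭ applyUpTo (s +_) m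
ends-blockArcs s 0             = [] , ↭-refl
ends-blockArcs s 1             = [ s + 0 ] , ↭-refl
ends-blockArcs s (suc (suc m)) with zs , ends↭ ← ends-blockArcs (suc s) m = zs , (begin
  ends (blockArcs s (2 + m)) ++ zs
    ≡⟨ cong (λ es → ends es ++ zs) (blockArcs-suc s m) ⟩
  ends (edge (s + 0) (s + suc m) ∷ blockArcs (suc s) m) ++ zs
    ↭⟨ ++⁺ʳ zs (ends-edge∷ (s + 0) (s + suc m) (blockArcs (suc s) m)) ⟩
  s + 0 ∷ s + suc m ∷ ends (blockArcs (suc s) m) ++ zs
    ↭⟨ prep _ (prep _ ends↭) ⟩
  s + 0 ∷ s + suc m ∷ applyUpTo (suc s +_) m
    ↭⟨ prep _ (++-comm [ s + suc m ] _) ⟩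
  s + 0 ∷ applyUpTo (suc s +_) m ∷ʳ (s + suc m)
    ≡⟨ cong (λ xs → s + 0 ∷ xs ∷ʳ (s + suc m)) (applyUpTo-cong (ℕ.+-suc s) m) ⟨
  s + 0 ∷ applyUpTo ((s +_) ∘ suc) m ∷ʳ (s + suc m)
    ≡⟨ cong (s + 0 ∷_) (applyUpTo-∷ʳ ((s +_) ∘ suc) m) ⟩
  applyUpTo (s +_) (2 + m) ∎)
  where open PermutationReasoning

ends-arcsFrom : ∀ s ms → ∃[ zs ] ends (arcsFrom s ms) ++ zs ↭ applyUpTo (s +_) (sum ms)
ends-arcsFrom s []       = [] , ↭-refl
ends-arcsFrom s (m ∷ ms)
  with zs₁ , ends↭₁ ← ends-blockArcs s m | zs₂ , ends↭₂ ← ends-arcsFrom (s + m) ms =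
  zs₁ ++ zs₂ , (begin
  ends (blockArcs s m ++ arcsFrom (s + m) ms) ++ zs₁ ++ zs₂
    ≡⟨ cong (_++ zs₁ ++ zs₂) (ends-++ (blockArcs s m) _) ⟩
  (ends (blockArcs s m) ++ ends (arcsFrom (s + m) ms)) ++ zs₁ ++ zs₂
    ↭⟨ interchange (ends (blockArcs s m)) _ zs₁ zs₂ ⟩
  (ends (blockArcs s m) ++ zs₁) ++ ends (arcsFrom (s + m) ms) ++ zs₂
    ↭⟨ ++⁺ ends↭₁ ends↭₂ ⟩
  applyUpTo (s +_) m ++ applyUpTo (s + m +_) (sum ms)
    ≡⟨ cong (applyUpTo (s +_) m ++_) (applyUpTo-cong (ℕ.+-assoc s m) (sum ms)) ⟩
  applyUpTo (s +_) m ++ applyUpTo ((s +_) ∘ (m +_)) (sum ms)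
    ≡⟨ applyUpTo-+ (s +_) m (sum ms) ⟨
  applyUpTo (s +_) (m + sum ms) ∎)
  where open PermutationReasoning

arcsFrom-ordered : ∀ s ms → All Ordered (arcsFrom s ms)
arcsFrom-ordered s []       = []
arcsFrom-ordered s (m ∷ ms) = All.++⁺
  (All.map⁺ (All.universal (λ j → ℕ.m⊓n≤m⊔n (s + j) (s + (m ∸ 1 ∸ j))) _))
  (arcsFrom-ordered (s + m) ms)

length-arcsFrom : ∀ s ms → length (arcsFrom s ms) ≡ sum (map ⌊_/2⌋ ms)
length-arcsFrom s []       = refl
length-arcsFrom s (m ∷ ms) = trans (length-++ (blockArcs s m))
  (cong₂ _+_ (trans (length-map _ (upTo ⌊ m /2⌋)) (length-upTo ⌊ m /2⌋))
             (length-arcsFrom (s + m) ms))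

-- Top and bottom arcs each use a vertex at most once, so degrees are at most 2; equal sums make the
-- two rows cover the same vertices.
#paths-meander : ∀ xs ys → sum ys ≡ sum xs →
  #paths (meander xs ys) + (sum (map ⌊_/2⌋ xs) + sum (map ⌊_/2⌋ ys)) ≡ sum xs
#paths-meander xs ys Σys≡Σxs
  with zs₁ , ends↭₁ ← ends-arcsFrom 0 xs | zs₂ , ends↭₂ ← ends-arcsFrom 0 ys = trans
  (cong (#paths (meander xs ys) +_) (sym (trans (length-++ (arcsFrom 0 xs))
    (cong₂ _+_ (length-arcsFrom 0 xs) (length-arcsFrom 0 ys)))))
  (#paths-+-edges {zs = zs₁ ++ zs₂}
    (All.++⁺ (arcsFrom-ordered 0 xs) (arcsFrom-ordered 0 ys)) (begin
  ends (arcsFrom 0 xs ++ arcsFrom 0 ys) ++ zs₁ ++ zs₂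
    ≡⟨ cong (_++ zs₁ ++ zs₂) (ends-++ (arcsFrom 0 xs) _) ⟩
  (ends (arcsFrom 0 xs) ++ ends (arcsFrom 0 ys)) ++ zs₁ ++ zs₂
    ↭⟨ interchange (ends (arcsFrom 0 xs)) _ zs₁ zs₂ ⟩
  (ends (arcsFrom 0 xs) ++ zs₁) ++ ends (arcsFrom 0 ys) ++ zs₂
    ↭⟨ ++⁺ ends↭₁ ends↭₂ ⟩
  upTo (sum xs) ++ upTo (sum ys)
    ≡⟨ cong (λ n → upTo (sum xs) ++ upTo n) Σys≡Σxs ⟩
  upTo (sum xs) ++ upTo (sum xs) ∎))
  where open PermutationReasoning

#paths-⌈/2⌉ : ∀ xs → #paths (meander xs [ sum xs ]) + sum (map ⌊_/2⌋ xs) ≡ ⌈ sum xs /2⌉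
#paths-⌈/2⌉ xs = ℕ.+-cancelʳ-≡ ⌊ n /2⌋ _ _ (begin
  P + S + ⌊ n /2⌋            ≡⟨ ℕ.+-assoc P S ⌊ n /2⌋ ⟩
  P + (S + ⌊ n /2⌋)          ≡⟨ cong (λ k → P + (S + k)) (ℕ.+-identityʳ ⌊ n /2⌋) ⟨
  P + (S + (⌊ n /2⌋ + 0))    ≡⟨ #paths-meander xs [ n ] (ℕ.+-identityʳ n) ⟩
  n                          ≡⟨ ℕ.⌊n/2⌋+⌈n/2⌉≡n n ⟨
  ⌊ n /2⌋ + ⌈ n /2⌉          ≡⟨ ℕ.+-comm ⌊ n /2⌋ ⌈ n /2⌉ ⟩
  ⌈ n /2⌉ + ⌊ n /2⌋          ∎)
  where
  open ≡-Reasoning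
  n = sum xs
  P = #paths (meander xs [ n ])
  S = sum (map ⌊_/2⌋ xs)

-- Signs

-- Negative on `yes`, because `P` will be evenness of the index and `E-ind` subtracts the even ones.
sign : ∀ {P : Set} → Dec P → ℤ
sign P? = if does P? then -1ℤ else 1ℤ

-1^[2*n]≡1 : ∀ n → -1ℤ ^ (2 * n) ≡ 1ℤ
-1^[2*n]≡1 n = trans (sym (ℤ.^-*-assoc -1ℤ 2 n)) (ℤ.^-zeroˡ n)

even⊎odd : ∀ n → ∃[ k ] (n ≡ 2 * k ⊎ n ≡ suc (2 * k))
even⊎odd zero    = 0 , inj₁ refl
even⊎odd (suc n) with even⊎odd n
... | k , inj₁ eq = k , inj₂ (cong suc eq)
... | k , inj₂ eq = suc k , inj₁ (trans (cong suc eq) (sym (ℕ.*-suc 2 k)))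

sign-pred : ∀ n → sign (ℤ.+ 2 ℤ.∣? ℤ.+ n -ℤ 1ℤ) ≡ -1ℤ ^ n
sign-pred n with even⊎odd n
... | k , inj₁ refl = trans
  (cong (if_then -1ℤ else 1ℤ) (dec-false (ℤ.+ 2 ℤ.∣? ℤ.+ (2 * k) -ℤ 1ℤ) ¬2∣2k-1))
  (sym (-1^[2*n]≡1 k))
  where
  2∣2k : ℤ.+ 2 ℤ.∣ ℤ.+ (2 * k)
  2∣2k = ℤ.divides (ℤ.+ k) (trans (ℤ.pos-* 2 k) (ℤ.*-comm (ℤ.+ 2) (ℤ.+ k)))
  ¬2∣2k-1 : ¬ ℤ.+ 2 ℤ.∣ ℤ.+ (2 * k) -ℤ 1ℤ
  ¬2∣2k-1 2∣2k-1 with () ← ∣1⇒≡1 (ℤ.∣⇒∣ᵤ (ℤ.∣m+n∣m⇒∣n {n = -1ℤ} 2∣2k-1 2∣2k))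
... | k , inj₂ refl = trans
  (cong (if_then -1ℤ else 1ℤ) (dec-true (ℤ.+ 2 ℤ.∣? ℤ.+ (suc (2 * k)) -ℤ 1ℤ) 2∣2k))
  (sym (cong (-1ℤ *ℤ_) (-1^[2*n]≡1 k)))
  where
  2∣2k : ℤ.+ 2 ℤ.∣ ℤ.+ (2 * k)
  2∣2k = ℤ.divides (ℤ.+ k) (trans (ℤ.pos-* 2 k) (ℤ.*-comm (ℤ.+ 2) (ℤ.+ k)))

sign-ind : ∀ xs → -1ℤ ^ ⌈ sum xs /2⌉ *ℤ sign (ℤ.+ 2 ℤ.∣? ind xs) ≡ weight xs
-- The convention ind(∅) = -1 is odd, so the sign is 1, as is the weight of the empty partition.
sign-ind []         = refl
sign-ind xs@(_ ∷ _) = begin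
  -1ℤ ^ ⌈ sum xs /2⌉ *ℤ sign (ℤ.+ 2 ℤ.∣? ind xs)
    ≡⟨ cong₂ _*ℤ_ (cong (-1ℤ ^_) (sym (#paths-⌈/2⌉ xs))) (sign-pred (2 * C + P)) ⟩
  -1ℤ ^ (P + S) *ℤ -1ℤ ^ (2 * C + P)
    ≡⟨ ℤ.^-distribˡ-+-* -1ℤ (P + S) (2 * C + P) ⟨
  -1ℤ ^ (P + S + (2 * C + P))
    -- One P comes from ⌈n/2⌉ = P + S and one from the index; together with 2C they form an even
    -- exponent.
    ≡⟨ cong (-1ℤ ^_) (ℕ-solve 3 (λ p s c → p :+ s :+ (con 2 :* c :+ p) := con 2 :* (p :+ c) :+ s)
         refl P S C) ⟩
  -1ℤ ^ (2 * (P + C) + S)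
    ≡⟨ ℤ.^-distribˡ-+-* -1ℤ (2 * (P + C)) S ⟩
  -1ℤ ^ (2 * (P + C)) *ℤ weight xs
    ≡⟨ cong (_*ℤ weight xs) (-1^[2*n]≡1 (P + C)) ⟩
  1ℤ *ℤ weight xs
    ≡⟨ ℤ.*-identityˡ (weight xs) ⟩
  weight xs ∎
  where
  open ≡-Reasoning
  open ℕ-Solver using (_:+_; _:*_; _:=_; con) renaming (solve to ℕ-solve)
  G = meander xs [ sum xs ]
  C = #cycles G
  P = #paths G
  S = sum (map ⌊_/2⌋ xs)

length-filter-difference : ∀ {A : Set} {P : A → Set} (P? : ∀ x → Dec (P x)) xs →
  ℤ.+ length (filter (λ x → ¬? (P? x)) xs) -ℤ ℤ.+ length (filter P? xs) ≡
  ∑ (map (λ x → sign (P? x)) xs)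
length-filter-difference P? []       = refl
length-filter-difference P? (x ∷ xs) with IH ← length-filter-difference P? xs | does (P? x)
... | true  = trans (ℤsolve 2 (λ a b → a :- (con 1ℤ :+ b) := con -1ℤ :+ (a :- b)) refl
    (ℤ.+ length (filter (λ x → ¬? (P? x)) xs)) (ℤ.+ length (filter P? xs))) (cong (-1ℤ +ℤ_) IH)
  where open ℤ-Solver using (_:+_; _:-_; _:=_; con) renaming (solve to ℤsolve)
... | false = trans
  (ℤ.+-assoc 1ℤ (ℤ.+ length (filter (λ x → ¬? (P? x)) xs)) (- (ℤ.+ length (filter P? xs))))
  (cong (1ℤ +ℤ_) IH)

∑-*ˡ : ∀ {A : Set} c {f g : A → ℤ} {xs} → All (λ x → c *ℤ f x ≡ g x) xs →
  c *ℤ ∑ (map f xs) ≡ ∑ (map g xs)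
∑-*ˡ c []         = ℤ.*-zeroʳ c
∑-*ˡ c (eq ∷ eqs) = trans (ℤ.*-distribˡ-+ c _ _) (cong₂ _+ℤ_ eq (∑-*ˡ c eqs))

E-ind-weight : ∀ n → -1ℤ ^ ⌈ n /2⌉ *ℤ E-ind n ≡ oddPartitionWeight n n
E-ind-weight n = trans
  (cong (-1ℤ ^ ⌈ n /2⌉ *ℤ_) (length-filter-difference (λ xs → ℤ.+ 2 ℤ.∣? ind xs) (oddPartitions n)))
  (∑-*ˡ (-1ℤ ^ ⌈ n /2⌉) (All.tabulate signs))
  where
  signs : ∀ {xs} → xs ∈ oddPartitions n → -1ℤ ^ ⌈ n /2⌉ *ℤ sign (ℤ.+ 2 ℤ.∣? ind xs) ≡ weight xs
  -- That `xs` sums to `n` identifies the global exponent ⌈n/2⌉ with the one in `sign-ind`.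
  signs {xs} xs∈ with _ , _ , refl ← partitions-sound n (proj₁ (∈-filter⁻ allOdd? xs∈)) = sign-ind xs

theorem1 : (λ n → -1ℤ ^ ⌈ n /2⌉ *ℤ E-ind n) ≐∏ (λ n → recip (𝟏 ⊕ (-1ℤ ^ n) q^ (2 * n ∸ 1)))
theorem1 k = k , λ M k≤M → trans (partialProduct-stable k≤M) (sym (E-ind-weight k))
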